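{- If $G$ is a triangle-free $K_4$-minor-free graph, then $G$ is $(2,2,1)$-AT extendable with respect to $(x,y,z)$ for all distinct vertices $x,y,z\in V(G)$.
   Context: All graphs are simple. For an orientation $D$ of $G$, an Eulerian sub-digraph is a spanning sub-digraph $F$ with $d_F^+(v)=d_F^-(v)$ for all $v$; $\mathrm{diff}(D)$ is the number of Eulerian sub-digraphs with an even number of arcs minus the number with an odd number; $D$ is an AT-orientation if $\mathrm{diff}(D)\ne0$. $G$ is $(2,2,1)$-AT extendable with respect to $(x,y,z)$ if $G$ has an AT-orientation $D$ with $d_D^+(x)\le1$, $d_D^+(y)\le1$, $d_D^+(z)=0$, and $d_D^+(v)\le2$ for all other vertices $v$. -}

module Defs where

open import Data.Nat using (ℕ; zero; suc; _+_; _*_; _≡ᵇ_; _≤_)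
open import Data.Integer as ℤ using (ℤ)
open import Data.Bool using (Bool; true; false; if_then_else_; _∧_; T)
open import Data.Fin using (Fin; combine)
open import Data.Vec using (Vec; []; _∷_; lookup)
open import Data.List using (List; []; _∷_; [_]; map; allFin; concatMap)
open import Data.Nat.ListAction using (sum)
open import Data.Bool.ListAction using (all)
open import Data.Maybe using (Maybe; just)
open import Data.Product using (Σ; ∃; ∃-syntax; _×_; _,_)
open import Relation.Binary.PropositionalEquality using (_≡_; _≢_)
open import Relation.Nullary using (¬_)
open import Data.Empty using (⊥)
open import Data.Sum using (_⊎_)

record Graph (n : ℕ) : Set where
  field
    adj    : Fin n → Fin n → Bool
    sym    : ∀ u v → adj u v ≡ adj v u
    irrefl : ∀ v → adj v v ≡ false
open Graph public

-- Triangle-free (no three pairwise adjacent vertices; they are distinct by irreflexivity).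
TriangleFree : ∀ {n} → Graph n → Set
TriangleFree {n} G = ∀ (a b c : Fin n) →
  adj G a b ≡ true → adj G b c ≡ true → adj G a c ≡ true → ⊥

data WalkIn {n} (G : Graph n) (S : Fin n → Set) : Fin n → Fin n → Set where
  here : ∀ {u} → S u → WalkIn G S u u
  step : ∀ {u v w} → S u → adj G u v ≡ true → WalkIn G S v w → WalkIn G S u w

-- G has a K4 minor: four disjoint nonempty connected branch sets, pairwise joined by an edge.
-- b v = just i means v lies in branch set i; b v = nothing means v is deleted.
HasK4Minor : ∀ {n} → Graph n → Set
HasK4Minor {n} G = Σ (Fin n → Maybe (Fin 4)) λ b →
    (∀ i → ∃[ v ] b v ≡ just i)
  × (∀ i u v → b u ≡ just i → b v ≡ just i → WalkIn G (λ w → b w ≡ just i) u v)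
  × (∀ i j → i ≢ j → ∃[ u ] ∃[ v ] (b u ≡ just i × b v ≡ just j × adj G u v ≡ true))

K4MinorFree : ∀ {n} → Graph n → Set
K4MinorFree G = ¬ HasK4Minor G

record Orientation {n} (G : Graph n) : Set where
  field
    arc      : Fin n → Fin n → Bool
    arc⊆edge : ∀ u v → arc u v ≡ true → adj G u v ≡ true
    oriented : ∀ u v → adj G u v ≡ true →
               (arc u v ≡ true × arc v u ≡ false) ⊎ (arc u v ≡ false × arc v u ≡ true)
open Orientation public

outdeg : ∀ {n} → (Fin n → Fin n → Bool) → Fin n → ℕ
outdeg {n} r v = sum (map (λ u → if r v u then 1 else 0) (allFin n))

indeg : ∀ {n} → (Fin n → Fin n → Bool) → Fin n → ℕ
indeg {n} r v = sum (map (λ u → if r u v then 1 else 0) (allFin n))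

arcCount : ∀ {n} → (Fin n → Fin n → Bool) → ℕ
arcCount {n} r = sum (map (outdeg r) (allFin n))

allBoolVecs : (m : ℕ) → List (Vec Bool m)
allBoolVecs zero    = [ [] ]
allBoolVecs (suc m) = concatMap (λ v → (true ∷ v) ∷ (false ∷ v) ∷ []) (allBoolVecs m)

toRel : ∀ {n} → Vec Bool (n * n) → Fin n → Fin n → Bool
toRel w u v = lookup w (combine u v)

subRel : ∀ {n} → (Fin n → Fin n → Bool) → (Fin n → Fin n → Bool) → Bool
subRel {n} F A = all (λ u → all (λ v → if F u v then A u v else true) (allFin n)) (allFin n)

isEulerian : ∀ {n} → (Fin n → Fin n → Bool) → Bool
isEulerian {n} F = all (λ v → outdeg F v ≡ᵇ indeg F v) (allFin n)

sign : ℕ → ℤ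
sign zero          = ℤ.+ 1
sign (suc zero)    = ℤ.- (ℤ.+ 1)
sign (suc (suc k)) = sign k

-- diff(D) = #even Eulerian sub-digraphs − #odd Eulerian sub-digraphs.
-- Spanning sub-digraphs of D correspond bijectively to arc relations F ⊆ arc D,
-- enumerated as Boolean vectors of length n * n whose relation is contained in arc D.
diff : ∀ {n} {G : Graph n} → Orientation G → ℤ
diff {n} D = ℤsum (map term (allBoolVecs (n * n)))
  where
    ℤsum : List ℤ → ℤ
    ℤsum []       = ℤ.+ 0
    ℤsum (x ∷ xs) = x ℤ.+ ℤsum xs
    term : Vec Bool (n * n) → ℤ
    term w = if subRel (toRel {n} w) (arc D) ∧ isEulerian (toRel {n} w)
             then sign (arcCount (toRel {n} w)) else ℤ.+ 0

IsATOrientation : ∀ {n} {G : Graph n} → Orientation G → Set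
IsATOrientation D = diff D ≢ ℤ.+ 0

Extendable221 : ∀ {n} → Graph n → Fin n → Fin n → Fin n → Set
Extendable221 G x y z = Σ (Orientation G) λ D →
    IsATOrientation D
  × outdeg (arc D) x ≤ 1
  × outdeg (arc D) y ≤ 1
  × outdeg (arc D) z ≡ 0
  × (∀ v → v ≢ x → v ≢ y → v ≢ z → outdeg (arc D) v ≤ 2)

{-# OPTIONS --safe #-}
module Submission where

-- Put f(x) = f(y) = 1, f(z) = 0 and f = 2 elsewhere. A vertex with at most f neighbours among the remaining
-- vertices may be removed and made a source. If nothing is left, the orientation is acyclic. Otherwise all
-- vertices of the remaining core other than x, y, z have degree at least 3, and by variants of Dirac's theorem
-- (a K4-minor-free graph has nonadjacent vertices of degree at most 2), proved by contracting edges,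
-- x and y have exactly the same two neighbours a and b in the core, a and b have at most one further neighbour
-- each, and the core without a, b, x, y can be removed vertex by vertex. Orient a → x → b → y → a cyclically,
-- as a source of the remainder. The only Eulerian sub-digraphs are then the empty one and possibly this 4-cycle,
-- so diff > 0.

open import Defs hiding (sym)
open import Data.Bool using (Bool; true; false; if_then_else_; _∧_; not)
open import Data.Bool.ListAction using (all)
open import Data.Bool.Properties using (∧-identityʳ; ¬-not; not-¬; T-≡) renaming (_≟_ to _≟ᵇ_)
open import Data.Nat using (ℕ; zero; suc; _+_; _*_; _≡ᵇ_; _≤_; _<_; z≤n; s≤s; s≤s⁻¹)
open import Data.Integer as ℤ using (ℤ)
open import Data.Nat.ListAction using (sum)
open import Data.Nat.Properties using (+-suc; ≤-refl; ≤-reflexive; ≤-trans; m≤n⇒m≤1+n; n≤0⇒n≡0; <⇒≱; ≰⇒>; ≤-<-trans; _≤?_; ≡ᵇ⇒≡; ≡⇒≡ᵇ)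
open import Data.Fin using (Fin; zero; suc; combine)
open import Data.Fin.Properties using (_≟_; any?)
open import Data.List using (List; []; _∷_; map; allFin; filter; length; tabulate)
open import Data.List.Properties using (map-cong; map-tabulate; tabulate-cong)
import Data.List.Membership.DecPropositional as DecMembership
open import Data.List.Membership.Propositional using (_∈_; _∉_)
open import Data.List.Membership.Propositional.Properties using (∈-allFin; ∈-filter⁺; ∈-tabulate⁺; ∈-tabulate⁻)
open import Data.List.Relation.Unary.All as All using ([]; _∷_)
open import Data.List.Relation.Unary.All.Properties using (all⁺; all⁻)
open import Data.List.Relation.Unary.AllPairs using ([]; _∷_)
open import Data.List.Relation.Unary.Any as Any using (here; there)
open import Data.List.Relation.Unary.Any.Properties using (concatMap⁺)
open import Data.List.Relation.Unary.Unique.Propositional using (Unique)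
open import Data.List.Relation.Unary.Unique.Propositional.Properties using (tabulate⁺)
open import Data.Maybe using (Maybe; just; nothing)
open import Data.Product using (Σ; ∃; ∃-syntax; _×_; _,_; proj₁; proj₂)
open import Data.Sum using (_⊎_; inj₁; inj₂; [_,_]′; swap) renaming (map to map⊎)
open import Data.Vec using (Vec; lookup; replicate; []; _∷_)
open import Data.Vec.Properties using (lookup-replicate)
open import Data.Vec.Relation.Unary.All using ([]; _∷_)
open import Data.Vec.Relation.Unary.AllPairs using ([]; _∷_)
open import Data.Vec.Relation.Unary.Unique.Propositional.Properties using (lookup-injective)
open import Function using (_∘_; id; case_of_)
open import Function.Bundles using (Equivalence)
open import Relation.Binary.PropositionalEquality
  using (_≡_; _≢_; refl; sym; trans; cong; cong₂; subst; ≢-sym)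
open import Relation.Nullary
  using (¬_; Dec; yes; no; does; contradiction; _×-dec_; _⊎-dec_; ¬?; decidable-stable)
open import Relation.Nullary.Decidable using (dec-true; dec-false)
open import Relation.Unary using (Decidable)

-- A core is exactly what blocks an acyclic orientation: restricted to the core, such an orientation
-- would have a source exceeding its capacity. Call a vertex exceptional if its degree may be 1 or
-- 2. Contraction destroys triangle-freeness, so Dirac's theorem is first proved for arbitrary
-- graphs whose exceptional vertices are equal or adjacent. This form reproduces itself: contracting
-- an edge that lies in at most one triangle makes only the merged vertex and the apex of that
-- triangle exceptional. Triangle-freeness enters afterwards. It allows vertices of degree 2 to be
-- suppressed without lowering any other degree, which handles exceptional vertices that are not
-- adjacent.

private
  variable
    n : ℕ

  open module FinMembership {n} = DecMembership (_≟_ {n}) using (_∈?_)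

-- Finite predicates of small cardinality

data Size (P : Fin n → Set) : Set where
  none : (∀ t → ¬ P t) → Size P
  one  : ∀ w → P w → (∀ t → P t → t ≡ w) → Size P
  two  : ∀ w t → w ≢ t → P w → P t → (∀ s → P s → s ≡ w ⊎ s ≡ t) → Size P
  more : ∀ w t s → w ≢ t → w ≢ s → t ≢ s → P w → P t → P s → Size P

size? : {P : Fin n → Set} → Decidable P → Size P
size? P? with any? P?
... | no ∄w = none λ t Pt → ∄w (t , Pt)
... | yes (w , Pw) with any? (λ t → P? t ×-dec ¬? (w ≟ t))
...   | no ∄t = one w Pw only
  where
  only : ∀ t → _ → t ≡ w
  only t Pt with w ≟ t
  ... | yes refl = refl
  ... | no w≢t = contradiction (t , Pt , w≢t) ∄t
...   | yes (t , Pt , w≢t) with any? (λ s → P? s ×-dec ¬? (w ≟ s) ×-dec ¬? (t ≟ s))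
...     | yes (s , Ps , w≢s , t≢s) = more w t s w≢t w≢s t≢s Pw Pt Ps
...     | no ∄s = two w t w≢t Pw Pt only
  where
  only : ∀ s → _ → s ≡ w ⊎ s ≡ t
  only s Ps with w ≟ s | t ≟ s
  ... | yes refl | _ = inj₁ refl
  ... | no _ | yes refl = inj₂ refl
  ... | no w≢s | no t≢s = contradiction (s , Ps , w≢s , t≢s) ∄s

avoid₂ : {P : Fin n → Set} {u v w : Fin n} → u ≢ v → u ≢ w → v ≢ w → P u → P v → P w →
  ∀ p q → ∃ λ t → P t × t ≢ p × t ≢ q
avoid₂ {u = u} {v} {w} u≢v u≢w v≢w Pu Pv Pw p q with u ≟ p | u ≟ q | v ≟ p | v ≟ q
... | no u≢p | no u≢q | _ | _ = u , Pu , u≢p , u≢q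
... | _ | _ | no v≢p | no v≢q = v , Pv , v≢p , v≢q
... | yes refl | _ | yes v≡u | _ = contradiction (sym v≡u) u≢v
... | yes refl | _ | no _ | yes refl = w , Pw , ≢-sym u≢w , ≢-sym v≢w
... | no _ | yes refl | yes refl | _ = w , Pw , ≢-sym v≢w , ≢-sym u≢w
... | no _ | yes refl | no _ | yes v≡u = contradiction (sym v≡u) u≢v

-- Graphs with propositional adjacency; isolated vertices play the role of deleted ones

record DGraph (n : ℕ) : Set₁ where
  field
    Adj  : Fin n → Fin n → Set
    adj? : ∀ u v → Dec (Adj u v)
    symm : ∀ {u v} → Adj u v → Adj v u
    irr  : ∀ {v} → ¬ Adj v v

  adj⇒≢ : ∀ {u v} → Adj u v → u ≢ v
  adj⇒≢ uv refl = irr uv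
open DGraph

Triangleless : DGraph n → Set
Triangleless R = ∀ {a b c} → Adj R a b → Adj R b c → ¬ Adj R a c

data Walk (R : DGraph n) (P : Fin n → Set) : Fin n → Fin n → Set where
  here : ∀ {u} → P u → Walk R P u u
  step : ∀ {u v w} → P u → Adj R u v → Walk R P v w → Walk R P u w

walk-trans : {R : DGraph n} {P : Fin n → Set} {u v w : Fin n} →
  Walk R P u v → Walk R P v w → Walk R P u w
walk-trans (here _) w = w
walk-trans (step p e v) w = step p e (walk-trans v w)

-- Nonemptiness of the branch sets follows from the edges between them.
K4Minor : DGraph n → Set
K4Minor {n} R = Σ (Fin n → Maybe (Fin 4)) λ b →
    (∀ i u v → b u ≡ just i → b v ≡ just i → Walk R (λ w → b w ≡ just i) u v)
  × (∀ i j → i ≢ j → ∃[ u ] ∃[ v ] (b u ≡ just i × b v ≡ just j × Adj R u v))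

K4Minor-mono : {R R′ : DGraph n} → (∀ {u v} → Adj R′ u v → Adj R u v) → K4Minor R′ → K4Minor R
K4Minor-mono {R = R} {R′} R′⊆R (b , conn , edge) =
  b , (λ i u v p q → go (conn i u v p q)) ,
  λ i j i≢j → let u , v , p , q , e = edge i j i≢j in u , v , p , q , R′⊆R e
  where
  go : ∀ {P u v} → Walk R′ P u v → Walk R P u v
  go (here p) = here p
  go (step p e w) = step p (R′⊆R e) (go w)

K4-subgraph : (R : DGraph n) {s u v w : Fin n} →
  Adj R s u → Adj R s v → Adj R s w → Adj R u v → Adj R u w → Adj R v w → K4Minor R
K4-subgraph {n} R {s} {u} {v} {w} su sv sw uv uw vw = b , conn , edge
  where
  c : Fin 4 → Fin n
  c = lookup (s ∷ u ∷ v ∷ w ∷ [])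
  adj-c : ∀ i j → i ≢ j → Adj R (c i) (c j)
  adj-c zero zero i≢j = contradiction refl i≢j
  adj-c zero (suc zero) _ = su
  adj-c zero (suc (suc zero)) _ = sv
  adj-c zero (suc (suc (suc zero))) _ = sw
  adj-c (suc zero) zero _ = symm R su
  adj-c (suc zero) (suc zero) i≢j = contradiction refl i≢j
  adj-c (suc zero) (suc (suc zero)) _ = uv
  adj-c (suc zero) (suc (suc (suc zero))) _ = uw
  adj-c (suc (suc zero)) zero _ = symm R sv
  adj-c (suc (suc zero)) (suc zero) _ = symm R uv
  adj-c (suc (suc zero)) (suc (suc zero)) i≢j = contradiction refl i≢j
  adj-c (suc (suc zero)) (suc (suc (suc zero))) _ = vw
  adj-c (suc (suc (suc zero))) zero _ = symm R sw
  adj-c (suc (suc (suc zero))) (suc zero) _ = symm R uw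
  adj-c (suc (suc (suc zero))) (suc (suc zero)) _ = symm R vw
  adj-c (suc (suc (suc zero))) (suc (suc (suc zero))) i≢j = contradiction refl i≢j
  b : Fin n → Maybe (Fin 4)
  b t with any? (λ i → c i ≟ t)
  ... | yes (i , _) = just i
  ... | no _ = nothing
  b⇒c : ∀ i t → b t ≡ just i → c i ≡ t
  b⇒c i t eq with any? (λ i → c i ≟ t)
  b⇒c i t refl | yes (i , ci≡t) = ci≡t
  b∘c : ∀ i → b (c i) ≡ just i
  b∘c i with any? (λ j → c j ≟ c i)
  ... | no ∄j = contradiction (i , refl) ∄j
  ... | yes (j , cj≡ci) with j ≟ i
  ...   | yes refl = refl
  ...   | no j≢i = contradiction cj≡ci (adj⇒≢ R (adj-c j i j≢i))
  conn : ∀ i t t′ → b t ≡ just i → b t′ ≡ just i → Walk R (λ x → b x ≡ just i) t t′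
  conn i t t′ p q with b⇒c i t p | b⇒c i t′ q
  ... | refl | refl = here p
  edge : ∀ i j → i ≢ j → ∃[ t ] ∃[ t′ ] (b t ≡ just i × b t′ ≡ just j × Adj R t t′)
  edge i j i≢j = c i , c j , b∘c i , b∘c j , adj-c i j i≢j

-- Induced subgraphs and edge contractions

restrict : (R : DGraph n) {P : Fin n → Set} → Decidable P → DGraph n
restrict R {P} P? = record
  { Adj  = λ u v → Adj R u v × P u × P v
  ; adj? = λ u v → adj? R u v ×-dec P? u ×-dec P? v
  ; symm = λ (uv , Pu , Pv) → symm R uv , Pv , Pu
  ; irr  = λ (vv , _) → irr R vv
  }

-- v is merged into u and becomes isolated.
contract : DGraph n → (u v : Fin n) → DGraph n
contract R u v = record
  { Adj  = λ a b → a ≢ v × b ≢ v × a ≢ b × (Adj R a b ⊎ (a ≡ u × Adj R v b) ⊎ (b ≡ u × Adj R a v))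
  ; adj? = λ a b → ¬? (a ≟ v) ×-dec ¬? (b ≟ v) ×-dec ¬? (a ≟ b) ×-dec
             (adj? R a b ⊎-dec ((a ≟ u) ×-dec adj? R v b) ⊎-dec ((b ≟ u) ×-dec adj? R a v))
  ; symm = λ (a≢v , b≢v , a≢b , e) → b≢v , a≢v , ≢-sym a≢b , flip e
  ; irr  = λ (_ , _ , a≢a , _) → a≢a refl
  }
  where
  flip : ∀ {a b} → Adj R a b ⊎ (a ≡ u × Adj R v b) ⊎ (b ≡ u × Adj R a v) →
    Adj R b a ⊎ (b ≡ u × Adj R v a) ⊎ (a ≡ u × Adj R b v)
  flip (inj₁ ab) = inj₁ (symm R ab)
  flip (inj₂ (inj₁ (a≡u , vb))) = inj₂ (inj₂ (a≡u , symm R vb))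
  flip (inj₂ (inj₂ (b≡u , av))) = inj₂ (inj₁ (b≡u , symm R av))

-- The vertex `v` joins the branch set of `u`. A walk step created by the merging is rerouted
-- through the edge `uv`, and a connecting edge created by it ends at `v` itself.
contract-minor : (R : DGraph n) {u v : Fin n} → Adj R u v → K4Minor (contract R u v) → K4Minor R
contract-minor {n} R {u} {v} uv (b′ , conn′ , edge′) = b , conn , edge
  where
  b : Fin n → Maybe (Fin 4)
  b w with w ≟ v
  ... | yes _ = b′ u
  ... | no _ = b′ w
  b-v : b v ≡ b′ u
  b-v with v ≟ v
  ... | yes _ = refl
  ... | no v≢v = contradiction refl v≢v
  b-≢v : ∀ {w} → w ≢ v → b w ≡ b′ w
  b-≢v {w} w≢v with w ≟ v
  ... | yes w≡v = contradiction w≡v w≢v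
  ... | no _ = refl
  lift : ∀ {i s t} → s ≢ v → Walk (contract R u v) (λ w → b′ w ≡ just i) s t →
    Walk R (λ w → b w ≡ just i) s t
  lift s≢v (here p) = here (trans (b-≢v s≢v) p)
  lift s≢v (step p (_ , t≢v , _ , inj₁ st) w) =
    step (trans (b-≢v s≢v) p) st (lift t≢v w)
  lift s≢v (step p (_ , t≢v , _ , inj₂ (inj₁ (refl , vt))) w) =
    step (trans (b-≢v s≢v) p) uv (step (trans b-v p) vt (lift t≢v w))
  lift s≢v (step p (_ , t≢v , _ , inj₂ (inj₂ (refl , sv))) w) with lift t≢v w
  ... | w′ = step (trans (b-≢v s≢v) p) sv (step (trans b-v (start w)) (symm R uv) w′)
    where
    start : ∀ {i s t} → Walk (contract R u v) (λ w → b′ w ≡ just i) s t → b′ s ≡ just i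
    start (here p) = p
    start (step p _ _) = p
  u≢v : u ≢ v
  u≢v = adj⇒≢ R uv
  conn : ∀ i s t → b s ≡ just i → b t ≡ just i → Walk R (λ w → b w ≡ just i) s t
  conn i s t p q with s ≟ v | t ≟ v
  ... | yes refl | yes refl = here (trans b-v p)
  ... | yes refl | no t≢v =
    step (trans b-v p) (symm R uv) (lift u≢v (conn′ i u t p q))
  ... | no s≢v | yes refl =
    walk-trans (lift s≢v (conn′ i s u p q))
      (step (trans (b-≢v u≢v) q) uv (here (trans b-v q)))
  ... | no s≢v | no t≢v = lift s≢v (conn′ i s t p q)
  edge : ∀ i j → i ≢ j → ∃[ s ] ∃[ t ] (b s ≡ just i × b t ≡ just j × Adj R s t)
  edge i j i≢j with edge′ i j i≢j
  ... | s , t , p , q , s≢v , t≢v , _ , inj₁ st =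
    s , t , trans (b-≢v s≢v) p , trans (b-≢v t≢v) q , st
  ... | s , t , p , q , s≢v , t≢v , _ , inj₂ (inj₁ (refl , vt)) =
    v , t , trans b-v p , trans (b-≢v t≢v) q , vt
  ... | s , t , p , q , s≢v , t≢v , _ , inj₂ (inj₂ (refl , sv)) =
    s , v , trans (b-≢v s≢v) p , trans b-v q , sv

-- Degree conditions

-- The degree of v is 0 or at least 3.
Hi : DGraph n → Fin n → Set
Hi R v = ∀ {w} → Adj R v w → ∀ p q → ∃ λ t → Adj R v t × t ≢ p × t ≢ q

record Two (R : DGraph n) (v a b : Fin n) : Set where
  constructor mkTwo
  field
    a≢b   : a ≢ b
    adj-a : Adj R v a
    adj-b : Adj R v b
    only  : ∀ t → Adj R v t → t ≡ a ⊎ t ≡ b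
open Two

two-swap : {R : DGraph n} {v a b : Fin n} → Two R v a b → Two R v b a
two-swap (mkTwo a≢b va vb only) = mkTwo (≢-sym a≢b) vb va λ t vt → swap (only t vt)

-- Isolated vertices fall under `high`: they stand for deleted vertices and must never count as
-- exceptional.
data Degree (R : DGraph n) (v : Fin n) : Set where
  high : Hi R v → Degree R v
  one  : ∀ a → Adj R v a → (∀ t → Adj R v t → t ≡ a) → Degree R v
  two  : ∀ a b → Two R v a b → Degree R v

degree : (R : DGraph n) → ∀ v → Degree R v
degree R v with size? (adj? R v)
... | none ∄ = high λ vw → contradiction vw (∄ _)
... | one a va only = one a va only
... | two a b a≢b va vb only = two a b (mkTwo a≢b va vb only)
... | more a b c a≢b a≢c b≢c va vb vc = high λ _ → avoid₂ a≢b a≢c b≢c va vb vc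

Hi-restrict : (R : DGraph n) {P : Fin n → Set} (P? : Decidable P) {v : Fin n} →
  (P v → ∀ {t} → Adj R v t → P t) → Hi R v → Hi (restrict R P?) v
Hi-restrict R P? closed hi (vw , Pv , _) p q =
  let t , vt , t≢p , t≢q = hi vw p q in t , (vt , Pv , closed Pv vt) , t≢p , t≢q

Hi-excluded : (R : DGraph n) {P : Fin n → Set} (P? : Decidable P) {v : Fin n} →
  ¬ P v → Hi (restrict R P?) v
Hi-excluded R P? ¬Pv (_ , Pv , _) = contradiction Pv ¬Pv

Hi-merged : (R : DGraph n) (u v : Fin n) → Hi (contract R u v) v
Hi-merged R u v (v≢v , _) = contradiction refl v≢v

-- Only a common neighbour of `u` and `v` loses degree, since two of its edges become one. For any
-- other `w`, the neighbour `v` is at most replaced by `u`.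
Hi-contract : (R : DGraph n) {u v w : Fin n} → w ≢ u → w ≢ v → ¬ (Adj R w u × Adj R w v) →
  Hi R w → Hi (contract R u v) w
Hi-contract R {u} {v} {w} w≢u w≢v ¬both hi {x} (_ , x≢v , _ , e) p q = find
  where
  R′ = contract R u v
  nbr : ∃ (Adj R w)
  nbr = [ (x ,_) , [ (λ (w≡u , _) → contradiction w≡u w≢u) , (λ (_ , wv) → v , wv) ]′ ]′ e
  keep : ∀ {t} → t ≢ v → Adj R w t → Adj R′ w t
  keep t≢v wt = w≢v , t≢v , adj⇒≢ R wt , inj₁ wt
  -- If u is among p, q, a third neighbour is sought avoiding u and v; here r is the other one.
  avoiding-u : ∀ r → ∃ λ t → Adj R′ w t × t ≢ u × t ≢ r
  avoiding-u r with adj? R w u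
  ... | yes wu = let t , wt , t≢u , t≢r = hi (proj₂ nbr) u r in
    t , keep (λ t≡v → ¬both (wu , subst (Adj R w) t≡v wt)) wt , t≢u , t≢r
  ... | no ¬wu = let t , wt , t≢v , t≢r = hi (proj₂ nbr) v r in
    t , keep t≢v wt , (λ t≡u → ¬wu (subst (Adj R w) t≡u wt)) , t≢r
  find : ∃ λ t → Adj R′ w t × t ≢ p × t ≢ q
  find with u ≟ p | u ≟ q
  ... | yes refl | _ = avoiding-u q
  ... | no _ | yes refl = let t , wt , t≢q , t≢p = avoiding-u p in t , wt , t≢p , t≢q
  ... | no u≢p | no u≢q with hi (proj₂ nbr) p q
  ...   | t , wt , t≢p , t≢q with t ≟ v
  ...     | no t≢v = t , keep t≢v wt , t≢p , t≢q
  ...     | yes refl = u , (w≢v , (λ { refl → ¬both (wt , wt) }) , w≢u , inj₂ (inj₂ (refl , wt))) , u≢p , u≢q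

-- Merging `v` into `a` turns the path through `a`, `v`, `b` into an edge `ab`. As this edge is new,
-- `a` and `b` keep their degrees, so no exceptional vertex arises.
module Suppress {R : DGraph n} {v a b : Fin n} (N : Two R v a b) (¬ab : ¬ Adj R a b) where

  R′ : DGraph n
  R′ = contract R a v

  minor : K4Minor R′ → K4Minor R
  minor = contract-minor R (symm R (adj-a N))

  b≢v : b ≢ v
  b≢v refl = irr R (adj-b N)

  a≢v : a ≢ v
  a≢v refl = irr R (adj-a N)

  new : Adj R′ a b
  new = a≢v , b≢v , a≢b N , inj₂ (inj₁ (refl , adj-b N))

  old : ∀ {c d} → c ≢ v → d ≢ v → Adj R c d → Adj R′ c d
  old c≢v d≢v cd = c≢v , d≢v , adj⇒≢ R cd , inj₁ cd

  cases : ∀ {c d} → Adj R′ c d → Adj R c d ⊎ (c ≡ a × d ≡ b) ⊎ (c ≡ b × d ≡ a)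
  cases (_ , _ , _ , inj₁ cd) = inj₁ cd
  cases {d = d} (_ , _ , c≢d , inj₂ (inj₁ (refl , vd))) with only N d vd
  ... | inj₁ refl = contradiction refl c≢d
  ... | inj₂ refl = inj₂ (inj₁ (refl , refl))
  cases {c = c} (_ , _ , c≢d , inj₂ (inj₂ (refl , cv))) with only N c (symm R cv)
  ... | inj₁ refl = contradiction refl c≢d
  ... | inj₂ refl = inj₂ (inj₂ (refl , refl))

  high-kept : ∀ w → (w ≢ v → Hi R w) → Hi R′ w
  high-kept w hi with w ≟ v | w ≟ a
  ... | yes refl | _ = Hi-merged R a v
  ... | no w≢v | no w≢a = Hi-contract R w≢a w≢v ¬both (hi w≢v)
    where
    ¬both : ¬ (Adj R w a × Adj R w v)
    ¬both (wa , wv) with only N w (symm R wv)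
    ... | inj₁ refl = irr R wa
    ... | inj₂ refl = ¬ab (symm R wa)
  ... | no w≢v | yes refl = λ _ p q → find p q
    where
    third : ∀ r → ∃ λ t → Adj R′ w t × t ≢ b × t ≢ r
    third r = let t , at , t≢v , t≢r = hi w≢v (symm R (adj-a N)) v r in
      t , old w≢v t≢v at , (λ t≡b → ¬ab (subst (Adj R a) t≡b at)) , t≢r
    find : ∀ p q → ∃ λ t → Adj R′ w t × t ≢ p × t ≢ q
    find p q with b ≟ p | b ≟ q
    ... | yes refl | _ = third q
    ... | no _ | yes refl = let t , at , t≢q , t≢p = third p in t , at , t≢p , t≢q
    ... | no b≢p | no b≢q = b , new , b≢p , b≢q

-- A form of Dirac's theorem

-- An adjacent pair of exceptional vertices is allowed because the contractions of the induction
-- create one; `p ≡ q` covers a single one. The edge with an end outside the pair excludes edgeless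
-- graphs and the single edge `pq`.
Dirac : DGraph n → Set
Dirac {n} R = ∀ (p q : Fin n) → p ≡ q ⊎ Adj R p q → (∀ v → v ≢ p → v ≢ q → Hi R v) →
  ∀ {t u} → Adj R t u → t ≢ p → t ≢ q → K4Minor R

-- Here `p` has degree 1 or 2, where `q ≡ w` encodes degree 1. Merging `p` into `q` leaves only `q`
-- and `w` exceptional and makes them equal or adjacent. The other exceptional vertex `r` is
-- absorbed, being `p` or `q`.
dirac-low : (R : DGraph n) {p q r w : Fin n} → Dirac (contract R q p) →
  Adj R q p → (∀ t → Adj R p t → t ≡ q ⊎ t ≡ w) → q ≡ w ⊎ Adj R p w →
  (∀ v → v ≢ p → v ≢ r → Hi R v) → r ≡ p ⊎ r ≡ q →
  ∀ {t u} → Adj R t u → t ≢ p → t ≢ r → K4Minor R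
dirac-low {n} R {p} {q} {r} {w} dirac′ qp only w? hi r? {t} {u} tu t≢p t≢r =
  contract-minor R qp (apply exists)
  where
  R′ = contract R q p
  p≢q : p ≢ q
  p≢q refl = irr R qp
  w≢p : w ≢ p
  w≢p refl = [ (λ { refl → irr R qp }) , irr R ]′ w?
  edge′ : q ≡ w ⊎ Adj R′ q w
  edge′ with q ≟ w
  ... | yes q≡w = inj₁ q≡w
  ... | no q≢w = [ inj₁ , (λ pw → inj₂ (≢-sym p≢q , w≢p , q≢w , inj₂ (inj₁ (refl , pw)))) ]′ w?
  hi′ : ∀ v → v ≢ q → v ≢ w → Hi R′ v
  hi′ v v≢q v≢w with v ≟ p
  ... | yes refl = Hi-merged R q p
  ... | no v≢p = Hi-contract R v≢q v≢p (λ (_ , vp) → [ v≢q , v≢w ]′ (only v (symm R vp)))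
    (hi v v≢p ([ (λ { refl → v≢p }) , (λ { refl → v≢q }) ]′ r?))
  apply : (∃[ t ] ∃[ u ] (Adj R′ t u × t ≢ q × t ≢ w)) → K4Minor R′
  apply (t , u , tu , t≢q , t≢w) = dirac′ q w edge′ hi′ tu t≢q t≢w
  exists : ∃[ t ] ∃[ u ] (Adj R′ t u × t ≢ q × t ≢ w)
  -- If `t` is one of the new exceptional vertices, a third neighbour of `t` outside the pair
  -- replaces it.
  exists with t ≟ q | t ≟ w
  ... | yes refl | _ = let s , ts , s≢p , s≢w = hi t t≢p t≢r tu p w in
    s , t , (s≢p , t≢p , adj⇒≢ R (symm R ts) , inj₁ (symm R ts)) , adj⇒≢ R (symm R ts) , s≢w
  ... | no _ | yes refl = let s , ts , s≢p , s≢q = hi t t≢p t≢r tu p q in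
    s , t , (s≢p , t≢p , adj⇒≢ R (symm R ts) , inj₁ (symm R ts)) , s≢q , adj⇒≢ R (symm R ts)
  ... | no t≢q | no t≢w =
    t , u , (t≢p , (λ { refl → [ t≢q , t≢w ]′ (only t (symm R tu)) }) , adj⇒≢ R tu , inj₁ tu) , t≢q , t≢w

-- Common neighbours of the ends of an edge

Common : DGraph n → (s u t : Fin n) → Set
Common R s u t = Adj R s t × Adj R u t

common? : (R : DGraph n) (s u : Fin n) → Decidable (Common R s u)
common? R s u t = adj? R s t ×-dec adj? R u t

-- Apart from the merged vertex `s`, only the common neighbour `w` can lose degree in the
-- contraction, and `s` is adjacent to it. Without a common neighbour, `w` is `s` and the pair
-- collapses to one vertex.
dirac-thin : (R : DGraph n) {s u : Fin n} → Dirac (contract R s u) → (∀ v → Hi R v) →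
  Adj R s u → ∀ w → s ≡ w ⊎ Common R s u w → (∀ t → Common R s u t → t ≡ w) → K4Minor R
dirac-thin R {s} {u} dirac′ hi su w w? thin with hi s su u w
... | t , st , t≢u , t≢w = contract-minor R su
  (dirac′ s w (edge′ w?) hi′ (t≢u , s≢u , ≢-sym (adj⇒≢ R st) , inj₁ (symm R st)) (≢-sym (adj⇒≢ R st)) t≢w)
  where
  s≢u : s ≢ u
  s≢u = adj⇒≢ R su
  edge′ : s ≡ w ⊎ Common R s u w → s ≡ w ⊎ Adj (contract R s u) s w
  edge′ (inj₁ s≡w) = inj₁ s≡w
  edge′ (inj₂ (sw , uw)) = inj₂ (s≢u , ≢-sym (adj⇒≢ R uw) , adj⇒≢ R sw , inj₁ sw)
  hi′ : ∀ v → v ≢ s → v ≢ w → Hi (contract R s u) v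
  hi′ v v≢s v≢w with v ≟ u
  ... | yes refl = Hi-merged R s u
  ... | no v≢u = Hi-contract R v≢s v≢u (λ (vs , vu) → v≢w (thin v (symm R vs , symm R vu))) (hi v)

Thick : DGraph n → Fin n → Set
Thick {n} R s = ∀ u → Adj R s u → ∀ p → ∃ λ t → Common R s u t × t ≢ p

-- w = s encodes that s and u have no common neighbour.
data Thickness (R : DGraph n) (s : Fin n) : Set where
  thin  : ∀ u → Adj R s u → ∀ w → s ≡ w ⊎ Common R s u w → (∀ t → Common R s u t → t ≡ w) →
          Thickness R s
  thick : Thick R s → Thickness R s

thickness : (R : DGraph n) → ∀ s → Thickness R s
thickness {n} R s = decide (any? thin?)
  where
  Thin : Fin n → Set
  Thin u = Adj R s u × ¬ (∃ λ t → ∃ λ t′ → Common R s u t × Common R s u t′ × t ≢ t′)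
  thin? : Decidable Thin
  thin? u = adj? R s u ×-dec
    ¬? (any? λ t → any? λ t′ → common? R s u t ×-dec common? R s u t′ ×-dec ¬? (t ≟ t′))
  decide : Dec (∃ Thin) → Thickness R s
  decide (yes (u , su , ∄)) with size? (common? R s u)
  ... | none ∄t = thin u su s (inj₁ refl) λ t c → contradiction c (∄t t)
  ... | one w c only = thin u su w (inj₂ c) only
  ... | two t t′ t≢t′ c c′ _ = contradiction (t , t′ , c , c′ , t≢t′) ∄
  ... | more t t′ _ t≢t′ _ _ c c′ _ = contradiction (t , t′ , c , c′ , t≢t′) ∄
  decide (no ∄thin) = thick two-common
    where
    pick : ∀ {u t t′} → t ≢ t′ → Common R s u t → Common R s u t′ → ∀ p → ∃ λ t → Common R s u t × t ≢ p
    pick {t = t} {t′} t≢t′ c c′ p with t ≟ p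
    ... | no t≢p = t , c , t≢p
    ... | yes refl = t′ , c′ , ≢-sym t≢t′
    two-common : Thick R s
    two-common u su p with size? (common? R s u)
    ... | none ∄t = contradiction (u , su , λ (t , _ , c , _) → ∄t t c) ∄thin
    ... | one w _ only = contradiction
      (u , su , λ (t , t′ , c , c′ , t≢t′) → t≢t′ (trans (only t c) (sym (only t′ c′)))) ∄thin
    ... | two _ _ t≢t′ c c′ _ = pick t≢t′ c c′ p
    ... | more _ _ _ t≢t′ _ _ c c′ _ = pick t≢t′ c c′ p

-- If every edge at s lies in two triangles, the neighbourhood of s has minimum degree 2.
-- In the subgraph induced by s and its neighbours, an edge uw of the neighbourhood can be contracted,
-- since a further common neighbour of u and w there completes a K4.
dirac-thick : (R : DGraph n) {s : Fin n} →
  (∀ {u w} → Adj R u w → (R₁ : DGraph n) → (∀ {c d} → Adj R₁ c d → Adj R c d) → Dirac (contract R₁ u w)) →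
  Thick R s → ∀ {u} → Adj R s u → K4Minor R
dirac-thick {n} R {s} dirac′ rich {u} su with rich u su u
... | w , (sw , uw) , _ with rich u su w
... | t , (st , ut) , t≢w with any? (λ x → adj? R s x ×-dec adj? R u x ×-dec adj? R w x)
...   | yes (x , sx , ux , wx) = K4-subgraph R su sw sx uw ux wx
...   | no ∄x = K4Minor-mono proj₁ (contract-minor R₁ uw₁
    (dirac′ uw R₁ proj₁ s u (inj₂ su₂) hi′ ts₂ (≢-sym (adj⇒≢ R st)) (≢-sym (adj⇒≢ R ut))))
  where
  In : Fin n → Set
  In v = v ≡ s ⊎ Adj R s v
  in? : Decidable In
  in? v = (v ≟ s) ⊎-dec adj? R s v
  R₁ = restrict R in?
  uw₁ : Adj R₁ u w
  uw₁ = uw , inj₂ su , inj₂ sw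
  su₂ : Adj (contract R₁ u w) s u
  su₂ = adj⇒≢ R sw , adj⇒≢ R uw , adj⇒≢ R su , inj₁ (su , inj₁ refl , inj₂ su)
  ts₂ : Adj (contract R₁ u w) t s
  ts₂ = t≢w , adj⇒≢ R sw , adj⇒≢ R (symm R st) , inj₁ (symm R st , inj₂ st , inj₁ refl)
  -- A neighbour `v` of `s` keeps in `R₁` the edge to `s` and the edges to two common neighbours
  -- with `s`.
  hi₁ : ∀ v → v ≢ s → Hi R₁ v
  hi₁ v v≢s (_ , inj₁ v≡s , _) = contradiction v≡s v≢s
  hi₁ v v≢s (_ , inj₂ sv , _) with rich v sv v
  ... | a , (sa , va) , _ with rich v sv a
  ...   | b , (sb , vb) , b≢a = avoid₂ (adj⇒≢ R sa) (adj⇒≢ R sb) (≢-sym b≢a)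
    (symm R sv , inj₂ sv , inj₁ refl) (va , inj₂ sv , inj₂ sa) (vb , inj₂ sv , inj₂ sb)
  hi′ : ∀ v → v ≢ s → v ≢ u → Hi (contract R₁ u w) v
  hi′ v v≢s v≢u with v ≟ w
  ... | yes refl = Hi-merged R₁ u w
  ... | no v≢w = Hi-contract R₁ v≢u v≢w ¬both (hi₁ v v≢s)
    where
    ¬both : ¬ (Adj R₁ v u × Adj R₁ v w)
    ¬both ((_ , inj₁ v≡s , _) , _) = v≢s v≡s
    ¬both ((vu , inj₂ sv , _) , vw , _) = ∄x (v , sv , symm R vu , symm R vw)

-- Counting

sum-map : (f : Fin n → ℕ) → sum (map f (allFin n)) ≡ sum (tabulate f)
sum-map f = cong sum (map-tabulate id f)

sum-cong : {f g : Fin n → ℕ} → (∀ u → f u ≡ g u) → sum (tabulate f) ≡ sum (tabulate g)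
sum-cong f≗g = cong sum (tabulate-cong f≗g)

bit : Bool → ℕ
bit b = if b then 1 else 0

count : (Fin n → Bool) → ℕ
count {n} P = sum (map (λ u → bit (P u)) (allFin n))

count-tabulate : (P : Fin n → Bool) → count P ≡ sum (tabulate (bit ∘ P))
count-tabulate P = sum-map (bit ∘ P)

_∖_ : (Fin n → Bool) → Fin n → Fin n → Bool
(P ∖ v) u = P u ∧ not (does (u ≟ v))

∖-⊆ : (P : Fin n → Bool) {v u : Fin n} → (P ∖ v) u ≡ true → P u ≡ true
∖-⊆ P {u = u} eq with P u
... | true = refl

∖-≢ : (P : Fin n → Bool) {v u : Fin n} → (P ∖ v) u ≡ true → u ≢ v
∖-≢ P {v} {u} eq with P u | u ≟ v
... | true | no u≢v = u≢v

∖-intro : (P : Fin n → Bool) {v u : Fin n} → P u ≡ true → u ≢ v → (P ∖ v) u ≡ true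
∖-intro P {v} {u} Pu u≢v rewrite Pu with u ≟ v
... | yes u≡v = contradiction u≡v u≢v
... | no _ = refl

count-cong : {P Q : Fin n → Bool} → (∀ u → P u ≡ Q u) → count P ≡ count Q
count-cong {n} P≗Q = cong sum (map-cong (λ u → cong bit (P≗Q u)) (allFin n))

count-remove : (P : Fin n → Bool) (v : Fin n) → P v ≡ true → count P ≡ suc (count (P ∖ v))
count-remove P v Pv = trans (count-tabulate P) (trans (go P v Pv) (cong suc (sym (count-tabulate (P ∖ v)))))
  where
  go : ∀ {n} (P : Fin n → Bool) v → P v ≡ true →
    sum (tabulate (bit ∘ P)) ≡ suc (sum (tabulate (bit ∘ (P ∖ v))))
  go P zero Pv rewrite Pv =
    cong suc (sum-cong λ u → cong bit (sym (∧-identityʳ (P (suc u)))))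
  go P (suc v) Pv rewrite ∧-identityʳ (P zero) =
    trans (cong (bit (P zero) +_) (go (P ∘ suc) v Pv)) (+-suc (bit (P zero)) _)

count-false : {P : Fin n → Bool} → (∀ u → P u ≡ false) → count P ≡ 0
count-false {n} {P} P≗false = trans (count-cong P≗false) (trans (count-tabulate {n} (λ _ → false)) (zeros n))
  where
  zeros : ∀ n → sum (tabulate {n = n} (λ _ → 0)) ≡ 0
  zeros zero = refl
  zeros (suc n) = zeros n

count-empty : (P : Fin n → Bool) → (∀ u → P u ≢ true) → count P ≡ 0
count-empty P ∄ = count-false λ u → ¬-not (∄ u)

count-≤ : (P : Fin n → Bool) (L : List (Fin n)) → (∀ u → P u ≡ true → u ∈ L) → count P ≤ length L
count-≤ P [] P⊆L = ≤-reflexive (count-empty P λ u Pu → case P⊆L u Pu of λ ())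
count-≤ P (v ∷ L) P⊆L with P v ≟ᵇ true
... | yes Pv = ≤-trans (≤-reflexive (count-remove P v Pv)) (s≤s (count-≤ (P ∖ v) L λ u u∈ →
  case P⊆L u (∖-⊆ P u∈) of λ { (here u≡v) → contradiction u≡v (∖-≢ P u∈) ; (there u∈L) → u∈L }))
... | no ¬Pv = m≤n⇒m≤1+n (count-≤ P L λ u Pu →
  case P⊆L u Pu of λ { (here refl) → contradiction Pu ¬Pv ; (there u∈L) → u∈L })

count-≡ : (P : Fin n → Bool) (L : List (Fin n)) → Unique L →
  (∀ u → P u ≡ true → u ∈ L) → (∀ u → u ∈ L → P u ≡ true) → count P ≡ length L
count-≡ P [] _ P⊆L _ = count-empty P λ u Pu → case P⊆L u Pu of λ ()
count-≡ P (v ∷ L) (v∉L ∷ uniq) P⊆L L⊆P = trans (count-remove P v (L⊆P v (here refl)))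
  (cong suc (count-≡ (P ∖ v) L uniq
    (λ u u∈ → case P⊆L u (∖-⊆ P u∈) of λ { (here u≡v) → contradiction u≡v (∖-≢ P u∈) ; (there u∈L) → u∈L })
    (λ u u∈L → ∖-intro P (L⊆P u (there u∈L)) λ { refl → All.lookup v∉L u∈L refl })))

count-≤1 : (P : Fin n → Bool) → count P ≤ 1 → ∀ {u v} → P u ≡ true → P v ≡ true → u ≡ v
count-≤1 P ≤1 {u} {v} Pu Pv with u ≟ v
... | yes u≡v = u≡v
... | no u≢v with ≤1 | trans (count-remove P u Pu) (cong suc (count-remove (P ∖ u) v (∖-intro P Pv (≢-sym u≢v))))
...   | ≤1′ | eq rewrite eq with s≤s () ← ≤1′

count-≢0 : (P : Fin n → Bool) {u : Fin n} → P u ≡ true → count P ≢ 0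
count-≢0 P {u} Pu eq with () ← trans (sym eq) (count-remove P u Pu)

count-> : (P : Fin n → Bool) (L : List (Fin n)) → length L < count P → ∃ λ u → P u ≡ true × u ∉ L
count-> P L L<P with any? (λ u → (P u ≟ᵇ true) ×-dec ¬? (u ∈? L))
... | yes found = found
... | no ∄ = contradiction (count-≤ P L λ u Pu → decidable-stable (u ∈? L) λ u∉L → ∄ (u , Pu , u∉L)) (<⇒≱ L<P)

-- Dirac's theorem by induction on the number of non-isolated vertices

-- All graphs of the induction share the vertex set `Fin n`, so the measure is the size of a set
-- containing the non-isolated vertices. A contraction removes the merged vertex from it.
Support : DGraph n → (Fin n → Bool) → Set
Support R S = ∀ {t u} → Adj R t u → S t ≡ true

support-contract : (R : DGraph n) {S : Fin n → Bool} {u v : Fin n} → Support R S → S u ≡ true →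
  Support (contract R u v) (S ∖ v)
support-contract R {S} supp Su (t≢v , _ , _ , inj₁ tx) = ∖-intro S (supp tx) t≢v
support-contract R {S} supp Su (t≢v , _ , _ , inj₂ (inj₁ (refl , _))) = ∖-intro S Su t≢v
support-contract R {S} supp Su (t≢v , _ , _ , inj₂ (inj₂ (_ , tv))) = ∖-intro S (supp tv) t≢v

count-∖ : ∀ {k} (S : Fin n → Bool) {v : Fin n} → count S ≤ suc k → S v ≡ true → count (S ∖ v) ≤ k
count-∖ S {v} ≤k Sv = s≤s⁻¹ (≤-trans (≤-reflexive (sym (count-remove S v Sv))) ≤k)

dirac-support : ∀ k (S : Fin n → Bool) → count S ≤ k → (R : DGraph n) → Support R S → Dirac R
dirac-support zero S ≤0 R supp _ _ _ _ tu _ _ = contradiction (n≤0⇒n≡0 ≤0) (count-≢0 S (supp tu))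
dirac-support {n} (suc k) S ≤k R supp p q p~q hi {t} {u} tu t≢p t≢q = go (degree R p) (degree R q)
  where
  -- The induction hypothesis must reach contractions of subgraphs too, because `dirac-thick` first
  -- passes to a neighbourhood.
  dirac-contract : ∀ {u v} → Adj R u v → (R₁ : DGraph n) → (∀ {c d} → Adj R₁ c d → Adj R c d) →
    Dirac (contract R₁ u v)
  dirac-contract {v = v} uv R₁ R₁⊆R =
    dirac-support k (S ∖ v) (count-∖ S ≤k (supp (symm R uv))) _ (support-contract R₁ (λ e → supp (R₁⊆R e)) (supp uv))
  all-high : (∀ v → Hi R v) → K4Minor R
  all-high hi with thickness R t
  ... | thin u tu w w? only = dirac-thin R (dirac-contract tu R id) hi tu w w? only
  ... | thick rich = dirac-thick R dirac-contract rich tu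
  low-one : ∀ {p r a} → Adj R p a → (∀ t → Adj R p t → t ≡ a) → p ≡ r ⊎ Adj R p r →
    (∀ v → v ≢ p → v ≢ r → Hi R v) → t ≢ p → t ≢ r → K4Minor R
  low-one pa only p~r hi t≢p t≢r =
    dirac-low R (dirac-contract (symm R pa) R id) (symm R pa) (λ t pt → inj₁ (only t pt)) (inj₁ refl)
      hi (map⊎ sym (only _) p~r) tu t≢p t≢r
  low-two : ∀ {p r a b} → Two R p a b → p ≡ r ⊎ Adj R p r →
    (∀ v → v ≢ p → v ≢ r → Hi R v) → t ≢ p → t ≢ r → K4Minor R
  low-two {p} {r} N p~r hi t≢p t≢r = choose (map⊎ sym (only N r) p~r)
    where
    merge : ∀ {a b} → Two R p a b → r ≡ p ⊎ r ≡ a → K4Minor R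
    merge N r? = dirac-low R (dirac-contract (symm R (adj-a N)) R id) (symm R (adj-a N)) (only N)
      (inj₂ (adj-b N)) hi r? tu t≢p t≢r
    -- If the other exceptional vertex `r` is a neighbour of `p`, then `p` has to be merged into `r`
    -- and not into its other neighbour.
    choose : r ≡ p ⊎ r ≡ _ ⊎ r ≡ _ → K4Minor R
    choose (inj₁ r≡p) = merge N (inj₁ r≡p)
    choose (inj₂ (inj₁ r≡a)) = merge N (inj₂ r≡a)
    choose (inj₂ (inj₂ r≡b)) = merge (two-swap N) (inj₂ r≡b)
  go : Degree R p → Degree R q → K4Minor R
  go (one a pa only) _ = low-one pa only p~q hi t≢p t≢q
  go (two a b N) _ = low-two N p~q hi t≢p t≢q
  go (high hi-p) (one a qa only) = low-one qa only (map⊎ sym (symm R) p~q) (λ v v≢q v≢p → hi v v≢p v≢q) t≢q t≢p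
  go (high hi-p) (two a b N) = low-two N (map⊎ sym (symm R) p~q) (λ v v≢q v≢p → hi v v≢p v≢q) t≢q t≢p
  go (high hi-p) (high hi-q) = all-high both
    where
    both : ∀ v → Hi R v
    both v with v ≟ p | v ≟ q
    ... | yes refl | _ = hi-p
    ... | no _ | yes refl = hi-q
    ... | no v≢p | no v≢q = hi v v≢p v≢q

dirac : (R : DGraph n) → Dirac R
dirac R = dirac-support _ (λ _ → true) ≤-refl R λ _ → refl

-- An edge always has an endpoint other than q.
dirac₁ : (R : DGraph n) (q : Fin n) → (∀ v → v ≢ q → Hi R v) → ∀ {t u} → Adj R t u → K4Minor R
dirac₁ R q hi {t} {u} tu with t ≟ q
... | no t≢q = dirac R q q (inj₁ refl) (λ v v≢q _ → hi v v≢q) tu t≢q t≢q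
... | yes refl = dirac R q q (inj₁ refl) (λ v v≢q _ → hi v v≢q) (symm R tu) u≢t u≢t
  where
  u≢t : u ≢ t
  u≢t = ≢-sym (adj⇒≢ R tu)

-- Triangle-free graphs with two or three exceptional vertices

_≢?_ : (u v : Fin n) → Dec (u ≢ v)
u ≢? v = ¬? (u ≟ v)

without : DGraph n → Fin n → DGraph n
without R v = restrict R (_≢? v)

restrict-triangleless : (R : DGraph n) {P : Fin n → Set} (P? : Decidable P) →
  Triangleless R → Triangleless (restrict R P?)
restrict-triangleless R P? tf (ab , _) (bc , _) (ac , _) = tf ab bc ac

two-nonadjacent : {R : DGraph n} → Triangleless R → ∀ {v a b} → Two R v a b → ¬ Adj R a b
two-nonadjacent tf N ab = tf (adj-a N) ab (adj-b N)

-- Since `p` and `q` may be far apart, `p` is eliminated to leave `q` alone. A `p` of degree 2 is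
-- suppressed; a `p` of degree 1 is deleted, after which its neighbour may have degree 2 and is
-- suppressed in turn.
two-exceptional : (R : DGraph n) → Triangleless R → ∀ p q → (∀ v → v ≢ p → v ≢ q → Hi R v) →
  ∀ {t u} → Adj R t u → t ≢ p → t ≢ q → K4Minor R
two-exceptional {n} R tf p q hi {t} {u} tu t≢p t≢q = go (degree R p)
  where
  only-q : Hi R p → ∀ v → v ≢ q → Hi R v
  only-q hi-p v v≢q with v ≟ p
  ... | yes refl = hi-p
  ... | no v≢p = hi v v≢p v≢q
  pendant : ∀ {c} → Adj R p c → (∀ t → Adj R p t → t ≡ c) → K4Minor (without R p)
  pendant {c} pc only = reattach (c ≟ q) (degree R₁ c)
    where
    R₁ = without R p
    c≢p : c ≢ p
    c≢p = ≢-sym (adj⇒≢ R pc)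
    hi₁ : ∀ v → v ≢ q → v ≢ c → Hi R₁ v
    hi₁ v v≢q v≢c with v ≟ p
    ... | yes refl = Hi-excluded R (_≢? p) λ p≢p → p≢p refl
    ... | no v≢p = Hi-restrict R (_≢? p) (λ { _ vt refl → v≢c (only v (symm R vt)) }) (hi v v≢p v≢q)
    edge₁ : ∃ λ s → Adj R₁ t s
    edge₁ = let s , ts , s≢p , _ = hi t t≢p t≢q tu p p in s , ts , t≢p , s≢p
    hi-c : Hi R₁ c → ∀ v → v ≢ q → Hi R₁ v
    hi-c h v v≢q with v ≟ c
    ... | yes refl = h
    ... | no v≢c = hi₁ v v≢q v≢c
    reattach : Dec (c ≡ q) → Degree R₁ c → K4Minor R₁
    reattach (yes refl) _ = dirac₁ R₁ q (λ v v≢q → hi₁ v v≢q v≢q) (proj₂ edge₁)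
    reattach (no c≢q) (high h) = dirac₁ R₁ q (hi-c h) (proj₂ edge₁)
    -- In `R` the vertex `c` has degree at least 3, so at least 2 neighbours survive the deletion of
    -- `p`.
    reattach (no c≢q) (one a _ only₁) with hi c c≢p c≢q (symm R pc) p a
    ... | s , cs , s≢p , s≢a = contradiction (only₁ s (cs , c≢p , s≢p)) s≢a
    reattach (no c≢q) (two a b N) =
      minor (dirac₁ R′ q (λ v v≢q → high-kept v (hi₁ v v≢q)) new)
      where open Suppress N (two-nonadjacent (restrict-triangleless R (_≢? p) tf) N)
  go : Degree R p → K4Minor R
  go (high h) = dirac₁ R q (only-q h) tu
  go (one c pc only) = K4Minor-mono proj₁ (pendant pc only)
  go (two a b N) = minor (dirac₁ R′ q (λ v v≢q → high-kept v (λ v≢p → hi v v≢p v≢q)) new)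
    where open Suppress N (two-nonadjacent tf N)

two-same : {R : DGraph n} {v a b c d : Fin n} → Two R v c d → a ≢ b → Adj R v a → Adj R v b → Two R v a b
two-same {a = a} {b} N a≢b va vb with only N a va | only N b vb
... | inj₁ refl | inj₁ refl = contradiction refl a≢b
... | inj₁ refl | inj₂ refl = N
... | inj₂ refl | inj₁ refl = two-swap N
... | inj₂ refl | inj₂ refl = contradiction refl a≢b

two-other : {R : DGraph n} {v a c d : Fin n} → Two R v c d → Adj R v a → ∃ λ b → Two R v a b
two-other {a = a} N va with only N a va
... | inj₁ refl = _ , N
... | inj₂ refl = _ , two-swap N

-- Adjacent exceptional vertices p, q of degree 2 lie on a path bpqd; if bd is not an edge, both can be suppressed,
-- and otherwise p and q can be deleted.
adjacent-pair : (R : DGraph n) → Triangleless R → {p q r b d e f : Fin n} →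
  Two R p q b → Two R q p d → Two R r e f → r ≢ p → r ≢ q →
  (∀ v → v ≢ p → v ≢ q → v ≢ r → Hi R v) → K4Minor R
adjacent-pair {n} R tf {p} {q} {r} {b} {d} {e} {f} Np Nq Nr r≢p r≢q hi = go (adj? R b d)
  where
  module S₁ = Suppress Np (two-nonadjacent tf Np)
  b≢d : b ≢ d
  b≢d refl = tf (adj-a Np) (adj-b Nq) (adj-b Np)
  d≢q : d ≢ q
  d≢q = ≢-sym (adj⇒≢ R (adj-b Nq))
  b≢p : b ≢ p
  b≢p = S₁.b≢v
  pd⊥ : ¬ Adj R d p
  pd⊥ dp = [ d≢q , ≢-sym b≢d ]′ (only Np d (symm R dp))
  qb⊥ : ¬ Adj R b q
  qb⊥ bq = [ b≢p , b≢d ]′ (only Nq b (symm R bq))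
  Nq₁ : Two S₁.R′ q b d
  Nq₁ = mkTwo b≢d S₁.new (S₁.old S₁.a≢v (≢-sym (a≢b Nq)) (adj-b Nq)) only₁
    where
    only₁ : ∀ t → Adj S₁.R′ q t → t ≡ b ⊎ t ≡ d
    only₁ t qt₁@(_ , t≢p , _) with S₁.cases qt₁
    ... | inj₁ qt = [ (λ t≡p → contradiction t≡p t≢p) , inj₂ ]′ (only Nq t qt)
    ... | inj₂ (inj₁ (_ , t≡b)) = inj₁ t≡b
    ... | inj₂ (inj₂ (q≡b , _)) = contradiction q≡b (a≢b Np)
  path : ¬ Adj R b d → K4Minor R
  path ¬bd = S₁.minor (S₂.minor (dirac₁ S₂.R′ r
    (λ v v≢r → S₂.high-kept v λ v≢q → S₁.high-kept v λ v≢p → hi v v≢p v≢q v≢r) S₂.new))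
    where
    ¬bd₁ : ¬ Adj S₁.R′ b d
    ¬bd₁ bd with S₁.cases bd
    ... | inj₁ bd = ¬bd bd
    ... | inj₂ (inj₁ (b≡q , _)) = a≢b Np (sym b≡q)
    ... | inj₂ (inj₂ (_ , d≡q)) = d≢q d≡q
    module S₂ = Suppress Nq₁ ¬bd₁
  cycle : Adj R b d → K4Minor R
  cycle bd = K4Minor-mono proj₁ (delete (r ≟ b) (r ≟ d))
    where
    rest? : Decidable λ v → v ≢ p × v ≢ q
    rest? v = (v ≢? p) ×-dec (v ≢? q)
    R₁ = restrict R rest?
    tf₁ : Triangleless R₁
    tf₁ = restrict-triangleless R rest? tf
    bd₁ : Adj R₁ b d
    bd₁ = bd , (b≢p , ≢-sym (a≢b Np)) , (≢-sym (a≢b Nq) , d≢q)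
    hi₁ : ∀ v → v ≢ b → v ≢ d → v ≢ r → Hi R₁ v
    hi₁ v v≢b v≢d v≢r with v ≟ p | v ≟ q
    ... | yes refl | _ = Hi-excluded R rest? λ (p≢p , _) → p≢p refl
    ... | no _ | yes refl = Hi-excluded R rest? λ (_ , q≢q) → q≢q refl
    ... | no v≢p | no v≢q = Hi-restrict R rest?
      (λ _ vt → (λ { refl → [ v≢q , v≢b ]′ (only Np v (symm R vt)) }) ,
                (λ { refl → [ v≢p , v≢d ]′ (only Nq v (symm R vt)) }))
      (hi v v≢p v≢q v≢r)
    -- The deletion can make `b` and `d` exceptional, but they are adjacent. The vertex `r` is one
    -- of them, or it still has degree 2 and is suppressed.
    delete : Dec (r ≡ b) → Dec (r ≡ d) → K4Minor R₁
    delete (yes refl) _ with hi d (≢-sym (a≢b Nq)) d≢q (≢-sym b≢d) (symm R bd) q b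
    ... | t , dt , t≢q , t≢b =
      dirac R₁ b d (inj₂ bd₁) (λ v v≢b v≢d → hi₁ v v≢b v≢d v≢b)
        (symm R dt , ((λ { refl → pd⊥ dt }) , t≢q) , (≢-sym (a≢b Nq) , d≢q)) t≢b (≢-sym (adj⇒≢ R dt))
    delete (no _) (yes refl) with hi b b≢p (≢-sym (a≢b Np)) b≢d bd p d
    ... | t , bt , t≢p , t≢d =
      dirac R₁ b d (inj₂ bd₁) (λ v v≢b v≢d → hi₁ v v≢b v≢d v≢d)
        (symm R bt , (t≢p , (λ { refl → qb⊥ bt })) , (b≢p , ≢-sym (a≢b Np))) (≢-sym (adj⇒≢ R bt)) t≢d
    delete (no r≢b) (no r≢d) = S₃.minor (finish (e ≟ b) (e ≟ d))
      where
      survives : ∀ {t} → Adj R r t → t ≢ p × t ≢ q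
      survives rt = (λ { refl → [ r≢q , r≢b ]′ (only Np r (symm R rt)) }) ,
                    (λ { refl → [ r≢p , r≢d ]′ (only Nq r (symm R rt)) })
      Nr₁ : Two R₁ r e f
      Nr₁ = mkTwo (a≢b Nr) (adj-a Nr , (r≢p , r≢q) , survives (adj-a Nr))
        (adj-b Nr , (r≢p , r≢q) , survives (adj-b Nr)) (λ t (rt , _) → only Nr t rt)
      module S₃ = Suppress Nr₁ (two-nonadjacent tf₁ Nr₁)
      apply : ∀ {t u} → Adj S₃.R′ t u → t ≢ b → t ≢ d → K4Minor S₃.R′
      apply = dirac S₃.R′ b d (inj₂ (S₃.old (≢-sym r≢b) (≢-sym r≢d) bd₁))
        (λ v v≢b v≢d → S₃.high-kept v (hi₁ v v≢b v≢d))
      ¬ef : ¬ Adj R e f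
      ¬ef = two-nonadjacent tf Nr
      -- As `bd` is an edge and `ef` was none, the new edge `ef` has an end outside the pair `b`,
      -- `d`.
      finish : Dec (e ≡ b) → Dec (e ≡ d) → K4Minor S₃.R′
      finish (no e≢b) (no e≢d) = apply S₃.new e≢b e≢d
      finish (yes refl) _ = apply (symm S₃.R′ S₃.new) (≢-sym (a≢b Nr)) λ { refl → ¬ef bd }
      finish (no _) (yes refl) = apply (symm S₃.R′ S₃.new) (λ { refl → ¬ef (symm R bd) }) (≢-sym (a≢b Nr))
  go : Dec (Adj R b d) → K4Minor R
  go (no ¬bd) = path ¬bd
  go (yes bd) = cycle bd

-- The 4-cycle prqb is attached to the rest of the graph only at b, so deleting p, q, r leaves no exceptional vertex but b.
attached-4-cycle : (R : DGraph n) {p q r b : Fin n} → Two R p r b → Two R q r b → Two R r p q →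
  (∀ v → v ≢ p → v ≢ q → v ≢ r → Hi R v) → K4Minor R
attached-4-cycle {n} R {p} {q} {r} {b} Np Nq Nr hi =
  let t , bt , t≢p , t≢q = hi b b≢p b≢q b≢r (symm R (adj-b Np)) p q in
  K4Minor-mono proj₁ (dirac₁ R₁ b hi₁ (bt , (b≢p , b≢q , b≢r) , (t≢p , t≢q , ≢r bt)))
  where
  b≢p : b ≢ p
  b≢p = ≢-sym (adj⇒≢ R (adj-b Np))
  b≢q : b ≢ q
  b≢q = ≢-sym (adj⇒≢ R (adj-b Nq))
  b≢r : b ≢ r
  b≢r = ≢-sym (a≢b Np)
  ≢r : ∀ {t} → Adj R b t → t ≢ r
  ≢r bt refl = [ b≢p , b≢q ]′ (only Nr b (symm R bt))
  rest? : Decidable λ v → v ≢ p × v ≢ q × v ≢ r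
  rest? v = (v ≢? p) ×-dec (v ≢? q) ×-dec (v ≢? r)
  R₁ = restrict R rest?
  hi₁ : ∀ v → v ≢ b → Hi R₁ v
  hi₁ v v≢b with v ≟ p | v ≟ q | v ≟ r
  ... | yes refl | _ | _ = Hi-excluded R rest? λ (p≢p , _) → p≢p refl
  ... | no _ | yes refl | _ = Hi-excluded R rest? λ (_ , q≢q , _) → q≢q refl
  ... | no _ | no _ | yes refl = Hi-excluded R rest? λ (_ , _ , r≢r) → r≢r refl
  ... | no v≢p | no v≢q | no v≢r = Hi-restrict R rest?
    (λ _ vt → (λ { refl → [ v≢r , v≢b ]′ (only Np v (symm R vt)) }) ,
              (λ { refl → [ v≢r , v≢b ]′ (only Nq v (symm R vt)) }) ,
              (λ { refl → [ v≢p , v≢q ]′ (only Nr v (symm R vt)) }))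
    (hi v v≢p v≢q v≢r)

-- Suppressing `p` and then `q` would leave `r` as the only exceptional vertex. So the second
-- suppression must be blocked: `cd` is an edge once `p` is suppressed, and not being an edge of
-- `R`, it is the new edge `ab`. If `r` were `a` or `b`, `attached-4-cycle` would apply.
three-of-degree-two : (R : DGraph n) → Triangleless R → ¬ K4Minor R → {p q r a b c d e f : Fin n} →
  Two R p a b → Two R q c d → Two R r e f → p ≢ q → r ≢ p → r ≢ q →
  (∀ v → v ≢ p → v ≢ q → v ≢ r → Hi R v) → Two R q a b × r ≢ a × r ≢ b
three-of-degree-two {n} R tf free {p} {q} {r} {a} {b} {c} {d} Np Nq Nr p≢q r≢p r≢q hi =
  Nq′ , r∉ Np Nq′ , r∉ (two-swap Np) (two-swap Nq′)
  where
  r∉ : ∀ {a b} → Two R p a b → Two R q a b → r ≢ a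
  r∉ Np Nq refl = free (attached-4-cycle R Np Nq
    (two-same Nr p≢q (symm R (adj-a Np)) (symm R (adj-a Nq))) hi)
  not-adjacent : ∀ {b} → ¬ Two R p q b
  not-adjacent Np = let d , Nq = two-other Nq (symm R (adj-a Np)) in
    free (adjacent-pair R tf Np Nq Nr r≢p r≢q hi)
  q≢a : q ≢ a
  q≢a refl = not-adjacent Np
  q≢b : q ≢ b
  q≢b refl = not-adjacent (two-swap Np)
  module S₁ = Suppress Np (two-nonadjacent tf Np)
  ≢p : ∀ {t} → Adj R q t → t ≢ p
  ≢p qt refl = [ q≢a , q≢b ]′ (only Np q (symm R qt))
  Nq₁ : Two S₁.R′ q c d
  Nq₁ = mkTwo (a≢b Nq) (S₁.old (≢-sym p≢q) (≢p (adj-a Nq)) (adj-a Nq))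
    (S₁.old (≢-sym p≢q) (≢p (adj-b Nq)) (adj-b Nq)) only₁
    where
    only₁ : ∀ t → Adj S₁.R′ q t → t ≡ c ⊎ t ≡ d
    only₁ t qt with S₁.cases qt
    ... | inj₁ qt = only Nq t qt
    ... | inj₂ (inj₁ (q≡a , _)) = contradiction q≡a q≢a
    ... | inj₂ (inj₂ (q≡b , _)) = contradiction q≡b q≢b
  suppress-both : ¬ Adj S₁.R′ c d → K4Minor R
  suppress-both ¬cd = S₁.minor (S₂.minor (dirac₁ S₂.R′ r
    (λ v v≢r → S₂.high-kept v λ v≢q → S₁.high-kept v λ v≢p → hi v v≢p v≢q v≢r) S₂.new))
    where module S₂ = Suppress Nq₁ ¬cd
  Nq′ : Two R q a b
  Nq′ with adj? S₁.R′ c d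
  ... | no ¬cd = contradiction (suppress-both ¬cd) free
  ... | yes cd with S₁.cases cd
  ...   | inj₁ cd = contradiction cd (two-nonadjacent tf Nq)
  ...   | inj₂ (inj₁ (refl , refl)) = Nq
  ...   | inj₂ (inj₂ (refl , refl)) = two-swap Nq

-- Three exceptional vertices, one of which may be a leaf

NotOne : DGraph n → Fin n → Set
NotOne R v = ∀ {w} → Adj R v w → ∃ λ t → Adj R v t × t ≢ w

-- Only the edge `qr` itself fails, and then a second neighbour of `q` provides another edge.
edge-outside : (R : DGraph n) {q : Fin n} → NotOne R q → ∀ r {t u} → Adj R t u →
  ∃[ t ] ∃[ u ] (Adj R t u × t ≢ q × t ≢ r)
edge-outside {n} R {q} not-one r {t} {u} tu = go (t ≟ q) (t ≟ r) (u ≟ q) (u ≟ r)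
  where
  third : Adj R q r → ∃[ t ] ∃[ u ] (Adj R t u × t ≢ q × t ≢ r)
  third qr = let s , qs , s≢r = not-one qr in s , q , symm R qs , ≢-sym (adj⇒≢ R qs) , s≢r
  go : Dec (t ≡ q) → Dec (t ≡ r) → Dec (u ≡ q) → Dec (u ≡ r) → ∃[ t ] ∃[ u ] (Adj R t u × t ≢ q × t ≢ r)
  go (no t≢q) (no t≢r) _ _ = t , u , tu , t≢q , t≢r
  go _ _ (no u≢q) (no u≢r) = u , t , symm R tu , u≢q , u≢r
  go (yes refl) _ (yes refl) _ = contradiction tu (irr R)
  go (yes refl) _ _ (yes refl) = third tu
  go _ (yes refl) (yes refl) _ = third (symm R tu)
  go _ (yes refl) _ (yes refl) = contradiction tu (irr R)

-- In a core, `NotOne` holds for vertices of capacity 1, while `z`, of capacity 0, may be a leaf. If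
-- one of the three were not exceptional, `two-exceptional` would yield a minor; hence `p` and `q`
-- have degree 2 and `r` has degree 1 or 2.
three-exceptional : (R : DGraph n) → Triangleless R → ¬ K4Minor R → {p q r : Fin n} →
  p ≢ q → r ≢ p → r ≢ q → NotOne R p → NotOne R q →
  (∀ v → v ≢ p → v ≢ q → v ≢ r → Hi R v) → ∀ {t u} → Adj R t u →
  ∃[ a ] ∃[ b ] (Two R p a b × Two R q a b × r ≢ a × r ≢ b)
three-exceptional {n} R tf free {p} {q} {r} p≢q r≢p r≢q not-one-p not-one-q hi tu =
  go (degree R p) (degree R q) (degree R r)
  where
  Goal = ∃[ a ] ∃[ b ] (Two R p a b × Two R q a b × r ≢ a × r ≢ b)
  drop : ∀ {s x y} → NotOne R x → Hi R s → (∀ v → v ≢ x → v ≢ y → v ≢ s → Hi R v) → K4Minor R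
  drop {s} {x} {y} not-one hi-s hi =
    let t , u , tu , t≢x , t≢y = edge-outside R not-one y tu in two-exceptional R tf x y hi′ tu t≢x t≢y
    where
    hi′ : ∀ v → v ≢ x → v ≢ y → Hi R v
    hi′ v v≢x v≢y with v ≟ s
    ... | yes refl = hi-s
    ... | no v≢s = hi v v≢x v≢y v≢s
  -- A leaf `r` is deleted, and its neighbour `e` takes over as third exceptional vertex.
  pendant : ∀ {a b c d e} → Two R p a b → Two R q c d → Adj R r e → (∀ t → Adj R r t → t ≡ e) → Goal
  pendant {a} {b} {c} {d} {e} Np Nq re only-e = go₁ (e ≟ p) (e ≟ q) (degree R₁ e)
    where
    R₁ = without R r
    tf₁ : Triangleless R₁
    tf₁ = restrict-triangleless R (_≢? r) tf
    free₁ : ¬ K4Minor R₁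
    free₁ m = free (K4Minor-mono proj₁ m)
    e≢r : e ≢ r
    e≢r = ≢-sym (adj⇒≢ R re)
    hi₁ : ∀ v → v ≢ p → v ≢ q → v ≢ e → Hi R₁ v
    hi₁ v v≢p v≢q v≢e with v ≟ r
    ... | yes refl = Hi-excluded R (_≢? r) λ r≢r → r≢r refl
    ... | no v≢r = Hi-restrict R (_≢? r) (λ { _ vt refl → v≢e (only-e v (symm R vt)) }) (hi v v≢p v≢q v≢r)
    at : ∀ {x y z w} → Two R x z w → x ≢ r → x ≢ e → x ≢ y →
      ∃ λ t → Adj R₁ t x × t ≢ x × t ≢ y
    at {x} {y} {z} {w} N x≢r x≢e x≢y with z ≟ y
    ... | no z≢y = z , (symm R (adj-a N) , (λ { refl → x≢e (only-e x (symm R (adj-a N))) }) , x≢r) ,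
      ≢-sym (adj⇒≢ R (adj-a N)) , z≢y
    ... | yes refl = w , (symm R (adj-b N) , (λ { refl → x≢e (only-e x (symm R (adj-b N))) }) , x≢r) ,
      ≢-sym (adj⇒≢ R (adj-b N)) , ≢-sym (a≢b N)
    keep : ∀ {x z w} → Two R x z w → x ≢ r → x ≢ e → Two R₁ x z w
    keep {x} N x≢r x≢e = mkTwo (a≢b N)
      (adj-a N , x≢r , λ { refl → x≢e (only-e x (symm R (adj-a N))) })
      (adj-b N , x≢r , λ { refl → x≢e (only-e x (symm R (adj-b N))) })
      λ t (xt , _) → only N t xt
    go₁ : Dec (e ≡ p) → Dec (e ≡ q) → Degree R₁ e → Goal
    go₁ (yes refl) _ _ = let t , tq , t≢q , t≢p = at Nq (≢-sym r≢q) (≢-sym p≢q) (≢-sym p≢q) in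
      contradiction (two-exceptional R₁ tf₁ p q (λ v v≢p v≢q → hi₁ v v≢p v≢q v≢p) tq t≢p t≢q) free₁
    go₁ (no _) (yes refl) _ = let t , tp , t≢p , t≢q = at Np (≢-sym r≢p) p≢q p≢q in
      contradiction (two-exceptional R₁ tf₁ p q (λ v v≢p v≢q → hi₁ v v≢p v≢q v≢q) tp t≢p t≢q) free₁
    go₁ (no e≢p) (no e≢q) (one g _ only₁) with hi e e≢p e≢q e≢r (symm R re) r g
    ... | s , es , s≢r , s≢g = contradiction (only₁ s (es , e≢r , s≢r)) s≢g
    go₁ (no e≢p) (no e≢q) (high h) with hi e e≢p e≢q e≢r (symm R re) r r
    ... | s , es , s≢r , _ = contradiction
      (two-exceptional R₁ tf₁ p q hi′ (es , e≢r , s≢r) e≢p e≢q) free₁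
      where
      hi′ : ∀ v → v ≢ p → v ≢ q → Hi R₁ v
      hi′ v v≢p v≢q with v ≟ e
      ... | yes refl = h
      ... | no v≢e = hi₁ v v≢p v≢q v≢e
    go₁ (no e≢p) (no e≢q) (two g h Ne) =
      let Nq₁ , _ = three-of-degree-two R₁ tf₁ free₁ (keep Np (≢-sym r≢p) (≢-sym e≢p))
                      (keep Nq (≢-sym r≢q) (≢-sym e≢q)) Ne p≢q e≢p e≢q hi₁
      in a , b , Np , two-same Nq (a≢b Np) (proj₁ (adj-a Nq₁)) (proj₁ (adj-b Nq₁)) ,
         (λ { refl → e≢p (sym (only-e p (symm R (adj-a Np)))) }) ,
         (λ { refl → e≢p (sym (only-e p (symm R (adj-b Np)))) })
  go : Degree R p → Degree R q → Degree R r → Goal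
  go (high h) _ _ = contradiction (drop not-one-q h λ v v≢q v≢r v≢p → hi v v≢p v≢q v≢r) free
  go (one a pa only) _ _ = let t , pt , t≢a = not-one-p pa in contradiction (only t pt) t≢a
  go (two _ _ _) (high h) _ = contradiction (drop not-one-p h λ v v≢p v≢r v≢q → hi v v≢p v≢q v≢r) free
  go (two _ _ _) (one a qa only) _ = let t , qt , t≢a = not-one-q qa in contradiction (only t qt) t≢a
  go (two _ _ _) (two _ _ _) (high h) = contradiction (drop not-one-p h hi) free
  go (two _ _ Np) (two _ _ Nq) (one e re only) = pendant Np Nq re only
  go (two a b Np) (two _ _ Nq) (two _ _ Nr) =
    a , b , Np , three-of-degree-two R tf free Np Nq Nr p≢q r≢p r≢q hi

-- Partial orientations and their Eulerian sub-digraphs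

BRel : ℕ → Set
BRel n = Fin n → Fin n → Bool

_⊆ᵇ_ : BRel n → BRel n → Set
F ⊆ᵇ A = ∀ {u v} → F u v ≡ true → A u v ≡ true

Eulerian : BRel n → Set
Eulerian F = ∀ v → outdeg F v ≡ indeg F v

NoArcs : BRel n → Set
NoArcs F = ∀ {u v} → F u v ≢ true

Positive : BRel n → Set
Positive F = sign (arcCount F) ≡ ℤ.+ 1

∧-intro : ∀ {a b} → a ≡ true → b ≡ true → a ∧ b ≡ true
∧-intro refl b = b

∧-trueˡ : ∀ {a b} → a ∧ b ≡ true → a ≡ true
∧-trueˡ {true} _ = refl

∧-trueʳ : ∀ a {b} → a ∧ b ≡ true → b ≡ true
∧-trueʳ true b = b

holds : {P : Set} (P? : Dec P) → does P? ≡ true → P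
holds (yes p) _ = p

count-mono : {P Q : Fin n → Bool} → (∀ u → P u ≡ true → Q u ≡ true) → count P ≤ count Q
count-mono {P = P} {Q} P⊆Q =
  subst (count P ≤_) (length-filter Q) (count-≤ P _ λ u Pu → ∈-filter⁺ (λ u → Q u ≟ᵇ true) (∈-allFin u) (P⊆Q u Pu))
  where
  length-filter : ∀ {n} (Q : Fin n → Bool) → length (filter (λ u → Q u ≟ᵇ true) (allFin n)) ≡ count Q
  length-filter {n} Q = go (allFin n)
    where
    go : ∀ L → length (filter (λ u → Q u ≟ᵇ true) L) ≡ sum (map (bit ∘ Q) L)
    go [] = refl
    go (u ∷ L) with Q u
    ... | true = cong suc (go L)
    ... | false = go L

in-arc : {F : BRel n} → Eulerian F → ∀ {u v} → F u v ≡ true → ∃ λ s → F s u ≡ true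
in-arc {F = F} euler {u} Fuv with any? (λ s → F s u ≟ᵇ true)
... | yes found = found
... | no ∄ = contradiction (trans (euler u) (count-empty (λ s → F s u) λ s Fsu → ∄ (s , Fsu))) (count-≢0 (F u) Fuv)

-- `S` holds the vertices present so far. `Q` records what is known of the Eulerian sub-digraphs:
-- `NoArcs` for the remainder beside the 4-cycle, `Positive` for the final orientation.
record PartialOrientation (G : Graph n) (f : Fin n → ℕ) (Q : BRel n → Set) (S : Fin n → Bool) : Set where
  field
    dir    : BRel n
    inside : ∀ {u v} → dir u v ≡ true → S u ≡ true × S v ≡ true
    edge   : ∀ {u v} → dir u v ≡ true → adj G u v ≡ true
    choice : ∀ {u v} → S u ≡ true → S v ≡ true → adj G u v ≡ true →
             (dir u v ≡ true × dir v u ≡ false) ⊎ (dir u v ≡ false × dir v u ≡ true)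
    bound  : ∀ v → outdeg dir v ≤ f v
    euler  : ∀ F → F ⊆ᵇ dir → Eulerian F → Q F

degreeIn : Graph n → (Fin n → Bool) → Fin n → ℕ
degreeIn G S v = count λ w → S w ∧ adj G v w

Core : Graph n → (Fin n → ℕ) → (Fin n → Bool) → Set
Core G f S = ∀ v → S v ≡ true → f v < degreeIn G S v

module _ {n : ℕ} {G : Graph n} {f : Fin n → ℕ} {Q : BRel n → Set} where

  no-loop : ∀ {v} → adj G v v ≢ true
  no-loop {v} vv with () ← trans (sym vv) (irrefl G v)

  -- An Eulerian sub-digraph using an arc out of `v` would also need an arc into `v`, and a source
  -- has none. So no new Eulerian sub-digraph appears, whatever `Q` is.
  add-source : ∀ {S v} → S v ≡ true → degreeIn G S v ≤ f v →
    PartialOrientation G f Q (S ∖ v) → PartialOrientation G f Q S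
  add-source {S} {v} Sv ≤f O = record
    { dir    = λ u w → does (arc? u w)
    ; inside = λ {u} {w} e → inside′ (holds (arc? u w) e)
    ; edge   = λ {u} {w} e → edge′ (holds (arc? u w) e)
    ; choice = choice′
    ; bound  = bound′
    ; euler  = λ F F⊆ eul → euler F (shrink F F⊆ eul) eul
    }
    where
    open PartialOrientation O
    Arc : Fin n → Fin n → Set
    Arc u w = (u ≡ v × S w ∧ adj G v w ≡ true) ⊎ dir u w ≡ true
    arc? : ∀ u w → Dec (Arc u w)
    arc? u w = ((u ≟ v) ×-dec (S w ∧ adj G v w ≟ᵇ true)) ⊎-dec (dir u w ≟ᵇ true)
    dir-into : ∀ {u} → dir u v ≢ true
    dir-into e = ∖-≢ S (proj₂ (inside e)) refl
    dir-from : ∀ {u} → dir v u ≢ true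
    dir-from e = ∖-≢ S (proj₁ (inside e)) refl
    arc-into : ∀ {u} → ¬ Arc u v
    arc-into (inj₁ (_ , e)) = no-loop (∧-trueʳ (S v) e)
    arc-into (inj₂ e) = dir-into e
    inside′ : ∀ {u w} → Arc u w → S u ≡ true × S w ≡ true
    inside′ (inj₁ (refl , e)) = Sv , ∧-trueˡ e
    inside′ (inj₂ e) = let p , q = inside e in ∖-⊆ S p , ∖-⊆ S q
    edge′ : ∀ {u w} → Arc u w → adj G u w ≡ true
    edge′ {w = w} (inj₁ (refl , e)) = ∧-trueʳ (S w) e
    edge′ (inj₂ e) = edge e
    choice′ : ∀ {u w} → S u ≡ true → S w ≡ true → adj G u w ≡ true →
      (does (arc? u w) ≡ true × does (arc? w u) ≡ false) ⊎ (does (arc? u w) ≡ false × does (arc? w u) ≡ true)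
    choice′ {u} {w} Su Sw uw = go (u ≟ v) (w ≟ v)
      where
      go : Dec (u ≡ v) → Dec (w ≡ v) → _
      go (yes refl) (yes refl) = contradiction uw no-loop
      go (yes refl) (no _) =
        inj₁ (dec-true (arc? u w) (inj₁ (refl , ∧-intro Sw uw)) , dec-false (arc? w u) arc-into)
      go (no _) (yes refl) =
        inj₂ (dec-false (arc? u w) arc-into , dec-true (arc? w u) (inj₁ (refl , ∧-intro Su (trans (Graph.sym G w u) uw))))
      go (no u≢v) (no w≢v) with choice (∖-intro S Su u≢v) (∖-intro S Sw w≢v) uw
      ... | inj₁ (e , ¬e) = inj₁ (dec-true (arc? u w) (inj₂ e) ,
        dec-false (arc? w u) [ (λ (w≡v , _) → w≢v w≡v) , not-¬ ¬e ]′)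
      ... | inj₂ (¬e , e) = inj₂ (dec-false (arc? u w) [ (λ (u≡v , _) → u≢v u≡v) , not-¬ ¬e ]′ ,
        dec-true (arc? w u) (inj₂ e))
    bound′ : ∀ u → count (λ w → does (arc? u w)) ≤ f u
    bound′ u = go (u ≟ v)
      where
      go : Dec (u ≡ v) → count (λ w → does (arc? u w)) ≤ f u
      go (yes refl) = ≤-trans
        (count-mono λ w e → [ proj₂ , (λ e → contradiction e dir-from) ]′ (holds (arc? u w) e)) ≤f
      go (no u≢v) = ≤-trans
        (count-mono λ w e → [ (λ (u≡v , _) → contradiction u≡v u≢v) , id ]′ (holds (arc? u w) e)) (bound u)
    shrink : ∀ F → F ⊆ᵇ (λ u w → does (arc? u w)) → Eulerian F → F ⊆ᵇ dir
    shrink F F⊆ eul {u} {w} Fuw with holds (arc? u w) (F⊆ Fuw)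
    ... | inj₂ e = e
    ... | inj₁ (refl , _) = let s , Fsv = in-arc eul Fuw in
      contradiction (holds (arc? s v) (F⊆ Fsv)) arc-into

  -- The treatment of a core is a parameter because peeling happens twice: on the whole graph, and
  -- again on the core without its 4-cycle.
  peel : ∀ k S → count S ≤ k →
    (∀ S′ → (∀ v → S′ v ≡ true → S v ≡ true) → Core G f S′ → PartialOrientation G f Q S′) →
    PartialOrientation G f Q S
  peel k S ≤k core with any? (λ v → (S v ≟ᵇ true) ×-dec (degreeIn G S v ≤? f v))
  ... | no ∄ = core S (λ _ Sv → Sv) λ v Sv → ≰⇒> λ ≤f → ∄ (v , Sv , ≤f)
  peel zero S ≤k core | yes (v , Sv , _) = contradiction (n≤0⇒n≡0 ≤k) (count-≢0 S Sv)
  peel (suc k) S ≤k core | yes (v , Sv , ≤f) = add-source Sv ≤f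
    (peel k (S ∖ v) (count-∖ S ≤k Sv) λ S′ S′⊆ → core S′ λ u S′u → ∖-⊆ S (S′⊆ u S′u))

  add-nothing : ∀ {S} → (∀ v → S v ≢ true) → (∀ F → NoArcs F → Q F) → PartialOrientation G f Q S
  add-nothing empty NoArcs⊆Q = record
    { dir    = λ _ _ → false
    ; inside = λ ()
    ; edge   = λ ()
    ; choice = λ Su → contradiction Su (empty _)
    ; bound  = λ v → ≤-trans (≤-reflexive (count-false {n} {λ _ → false} λ _ → refl)) z≤n
    ; euler  = λ F F⊆ _ → NoArcs⊆Q F λ e → case F⊆ e of λ ()
    }

sum-outdeg : {F : BRel n} (P : Fin n → Bool) → (∀ u → outdeg F u ≡ bit (P u)) → arcCount F ≡ count P
sum-outdeg {n} P eq = cong sum (map-cong eq (allFin n))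

noArcs-outdeg : {F : BRel n} → NoArcs F → ∀ u → outdeg F u ≡ 0
noArcs-outdeg {F = F} noArcs u = count-empty (F u) λ _ → noArcs

noArcs-arcCount : {F : BRel n} → NoArcs F → arcCount F ≡ 0
noArcs-arcCount {n} {F} noArcs =
  trans (sum-outdeg {F = F} (λ _ → false) (noArcs-outdeg noArcs)) (count-false {n} {λ _ → false} λ _ → refl)

noArcs-positive : (F : BRel n) → NoArcs F → Positive F
noArcs-positive F noArcs = cong sign (noArcs-arcCount {F = F} noArcs)

-- Adding a cyclically oriented 4-cycle

next : Fin 4 → Fin 4
next zero = suc zero
next (suc zero) = suc (suc zero)
next (suc (suc zero)) = suc (suc (suc zero))
next (suc (suc (suc zero))) = zero

next²-≢ : ∀ i → next (next i) ≢ i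
next²-≢ zero ()
next²-≢ (suc zero) ()
next²-≢ (suc (suc zero)) ()
next²-≢ (suc (suc (suc zero))) ()

next-injective : ∀ i j → next i ≡ next j → i ≡ j
next-injective i j eq = trans (sym (next⁴ i)) (trans (cong (next ∘ next ∘ next) eq) (next⁴ j))
  where
  next⁴ : ∀ i → next (next (next (next i))) ≡ i
  next⁴ zero = refl
  next⁴ (suc zero) = refl
  next⁴ (suc (suc zero)) = refl
  next⁴ (suc (suc (suc zero))) = refl

backward : {P : Fin 4 → Set} → (∀ j → P (next j) → P j) → ∀ i → P i → ∀ j → P j
backward {P} back i Pi = λ where
    zero → P0
    (suc zero) → P1
    (suc (suc zero)) → P2
    (suc (suc (suc zero))) → P3
  where
  to-zero : ∀ i → P i → P zero
  to-zero zero = id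
  to-zero (suc zero) = back _
  to-zero (suc (suc zero)) = back _ ∘ back (suc zero)
  to-zero (suc (suc (suc zero))) = back _ ∘ back (suc zero) ∘ back (suc (suc zero))
  P0 = to-zero i Pi
  P3 = back (suc (suc (suc zero))) P0
  P2 = back (suc (suc zero)) P3
  P1 = back (suc zero) P2

-- The 4-cycle is oriented cyclically and every other edge at it is directed away from it.
-- Vertices of an Eulerian sub-digraph on the cycle then have in-degree at most 1, so no arc leaves the cycle.
module _ {n : ℕ} {G : Graph n} {f : Fin n → ℕ} {S S′ : Fin n → Bool} (c : Fin 4 → Fin n)
  (c-injective : ∀ {i j} → c i ≡ c j → i ≡ j)
  (c-adjacent : ∀ i → adj G (c i) (c (next i)) ≡ true)
  (c-chordless : ∀ i j → adj G (c i) (c j) ≡ true → j ≡ next i ⊎ i ≡ next j)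
  (c∈S : ∀ i → S (c i) ≡ true)
  (S′⊆S : ∀ {v} → S′ v ≡ true → S v ≡ true)
  (c∉S′ : ∀ i → S′ (c i) ≢ true)
  (split : ∀ {v} → S v ≡ true → (∃ λ i → v ≡ c i) ⊎ S′ v ≡ true)
  -- The `suc` accounts for the arc along the cycle.
  (few : ∀ i → ∃ λ (L : List (Fin n)) →
    (∀ w → S′ w ≡ true → adj G (c i) w ≡ true → w ∈ L) × suc (length L) ≤ f (c i))
  (O : PartialOrientation G f NoArcs S′) where

  open PartialOrientation O

  private
    CycleArc : Fin n → Fin n → Set
    CycleArc u w = ∃ λ i → u ≡ c i × w ≡ c (next i)
    OutArc : Fin n → Fin n → Set
    OutArc u w = (∃ λ i → u ≡ c i) × S′ w ≡ true × adj G u w ≡ true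
    Arc : Fin n → Fin n → Set
    Arc u w = CycleArc u w ⊎ OutArc u w ⊎ dir u w ≡ true

    arc? : ∀ u w → Dec (Arc u w)
    arc? u w = any? (λ i → (u ≟ c i) ×-dec (w ≟ c (next i))) ⊎-dec
      (any? (λ i → u ≟ c i) ×-dec (S′ w ≟ᵇ true) ×-dec (adj G u w ≟ᵇ true)) ⊎-dec (dir u w ≟ᵇ true)

    arcs : BRel n
    arcs u w = does (arc? u w)

    to-cycle : ∀ {u i} → Arc u (c i) → ∃ λ j → u ≡ c j × next j ≡ i
    to-cycle (inj₁ (j , u≡ , eq)) = j , u≡ , sym (c-injective eq)
    to-cycle {i = i} (inj₂ (inj₁ (_ , S′ci , _))) = contradiction S′ci (c∉S′ i)
    to-cycle {i = i} (inj₂ (inj₂ e)) = contradiction (proj₂ (inside e)) (c∉S′ i)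

    from-inside : ∀ {u w} → S′ u ≡ true → Arc u w → dir u w ≡ true
    from-inside S′u (inj₁ (i , refl , _)) = contradiction S′u (c∉S′ i)
    from-inside S′u (inj₂ (inj₁ ((i , refl) , _))) = contradiction S′u (c∉S′ i)
    from-inside S′u (inj₂ (inj₂ e)) = e

    inside-S : ∀ {u w} → Arc u w → S u ≡ true × S w ≡ true
    inside-S (inj₁ (i , refl , refl)) = c∈S i , c∈S (next i)
    inside-S (inj₂ (inj₁ ((i , refl) , S′w , _))) = c∈S i , S′⊆S S′w
    inside-S (inj₂ (inj₂ e)) = let p , q = inside e in S′⊆S p , S′⊆S q

    arc-edge : ∀ {u w} → Arc u w → adj G u w ≡ true
    arc-edge (inj₁ (i , refl , refl)) = c-adjacent i
    arc-edge (inj₂ (inj₁ (_ , _ , uw))) = uw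
    arc-edge (inj₂ (inj₂ e)) = edge e

    one-way : ∀ {u w} → S u ≡ true → S w ≡ true → adj G u w ≡ true →
      (Arc u w × ¬ Arc w u) ⊎ (¬ Arc u w × Arc w u)
    one-way {u} {w} Su Sw uw = go (split Su) (split Sw)
      where
      back : ∀ j → ¬ Arc (c (next j)) (c j)
      back j a = let k , eq , nk≡j = to-cycle a in
        next²-≢ k (trans (cong next nk≡j) (c-injective eq))
      back-in : ∀ {v i} → S′ v ≡ true → ¬ Arc v (c i)
      back-in S′v a = let j , v≡ , _ = to-cycle a in c∉S′ j (trans (cong S′ (sym v≡)) S′v)
      go : (∃ λ i → u ≡ c i) ⊎ S′ u ≡ true → (∃ λ i → w ≡ c i) ⊎ S′ w ≡ true → _
      go (inj₁ (i , refl)) (inj₁ (j , refl)) with c-chordless i j uw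
      ... | inj₁ refl = inj₁ (inj₁ (i , refl , refl) , back i)
      ... | inj₂ refl = inj₂ (back j , inj₁ (j , refl , refl))
      go (inj₁ (i , refl)) (inj₂ S′w) = inj₁ (inj₂ (inj₁ ((i , refl) , S′w , uw)) , back-in S′w)
      go (inj₂ S′u) (inj₁ (j , refl)) =
        inj₂ (back-in S′u , inj₂ (inj₁ ((j , refl) , S′u , trans (Graph.sym G w u) uw)))
      go (inj₂ S′u) (inj₂ S′w) with choice S′u S′w uw
      ... | inj₁ (e , ¬e) = inj₁ (inj₂ (inj₂ e) , not-¬ ¬e ∘ from-inside S′w)
      ... | inj₂ (¬e , e) = inj₂ (not-¬ ¬e ∘ from-inside S′u , inj₂ (inj₂ e))

    arcs-bound : ∀ u → outdeg arcs u ≤ f u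
    arcs-bound u = go (any? λ i → u ≟ c i)
      where
      go : Dec (∃ λ i → u ≡ c i) → outdeg arcs u ≤ f u
      go (yes (i , refl)) = let L , ⊆L , ≤f = few i in
        ≤-trans (count-≤ (arcs (c i)) (c (next i) ∷ L) λ w e → list ⊆L (holds (arc? (c i) w) e)) ≤f
        where
        list : ∀ {L w} → (∀ w → S′ w ≡ true → adj G (c i) w ≡ true → w ∈ L) → Arc (c i) w → w ∈ c (next i) ∷ L
        list _ (inj₁ (j , eq , refl)) = here (cong (c ∘ next) (sym (c-injective eq)))
        list ⊆L (inj₂ (inj₁ (_ , S′w , e))) = there (⊆L _ S′w e)
        list _ (inj₂ (inj₂ e)) = contradiction (proj₁ (inside e)) (c∉S′ i)
      go (no ∄) = ≤-trans (count-mono λ w e → strip (holds (arc? u w) e)) (bound u)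
        where
        strip : ∀ {w} → Arc u w → dir u w ≡ true
        strip (inj₁ (i , u≡ , _)) = contradiction (i , u≡) ∄
        strip (inj₂ (inj₁ (u∈c , _))) = contradiction u∈c ∄
        strip (inj₂ (inj₂ e)) = e

    module Euler (F : BRel n) (F⊆ : F ⊆ᵇ arcs) (eul : Eulerian F) where

      to-arc : ∀ {u w} → F u w ≡ true → Arc u w
      to-arc {u} {w} e = holds (arc? u w) (F⊆ e)

      OnCycle : Fin 4 → Set
      OnCycle i = F (c i) (c (next i)) ≡ true

      predecessor : ∀ {i w} → F (c i) w ≡ true → ∃ λ j → OnCycle j × next j ≡ i
      predecessor e with in-arc eul e
      ... | s , e′ with to-cycle (to-arc e′)
      ...   | j , refl , refl = j , e′ , refl

      around : ∀ i → OnCycle i → ∀ j → OnCycle j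
      around = backward λ j e → let k , on , eq = predecessor e in
        subst OnCycle (next-injective k j eq) on

      -- An arc of `F` leaving the cycle vertex forces all four cycle arcs into `F`. Its out-degree
      -- equals its in-degree, which is at most 1, so its cycle arc is the only one leaving it.
      stays : ∀ {i w} → F (c i) w ≡ true → w ≡ c (next i)
      stays {i} {w} e with predecessor e
      ... | j , on , refl = count-≤1 (F (c (next j))) (≤-trans (≤-reflexive (eul (c (next j)))) ≤1) e (around j on (next j))
        where
        ≤1 : indeg F (c (next j)) ≤ 1
        ≤1 = count-≤ (λ u → F u (c (next j))) (c j ∷ []) λ u e → let k , u≡ , eq = to-cycle (to-arc e) in
          here (trans u≡ (cong c (next-injective k j eq)))

      -- These are the arcs of `F` with tail in the remainder. By `stays` no arc of `F` enters the
      -- remainder from the cycle, so `F′` is Eulerian and therefore has no arcs.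
      F′ : BRel n
      F′ u w = F u w ∧ S′ u

      F′⊆dir : F′ ⊆ᵇ dir
      F′⊆dir {u} {w} e = from-inside (∧-trueʳ (F u w) e) (to-arc (∧-trueˡ e))

      F′-eulerian : Eulerian F′
      F′-eulerian v with S′ v ≟ᵇ true
      ... | yes S′v = trans (count-cong λ w → trans (cong (F v w ∧_) S′v) (∧-identityʳ (F v w)))
                        (trans (eul v) (count-cong from-S′))
        where
        from-S′ : ∀ u → F u v ≡ F u v ∧ S′ u
        from-S′ u with F u v in e
        ... | false = refl
        ... | true with to-arc e
        ...   | inj₁ (i , _ , refl) = contradiction S′v (c∉S′ (next i))
        ...   | inj₂ (inj₂ e′) = sym (proj₁ (inside e′))
        ...   | inj₂ (inj₁ ((i , refl) , _)) with stays e
        ...     | refl = contradiction S′v (c∉S′ (next i))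
      ... | no ¬S′v = trans (count-empty (F′ v) λ w e → ¬S′v (∧-trueʳ (F v w) e))
        (sym (count-empty (λ u → F′ u v) λ u e → ¬S′v (proj₂ (inside (F′⊆dir e)))))

      F-on-cycle : ∀ {u w} → F u w ≡ true → CycleArc u w
      F-on-cycle {u} {w} e with to-arc e
      ... | inj₁ cyc = cyc
      ... | inj₂ (inj₁ ((i , refl) , _)) = i , refl , stays e
      ... | inj₂ (inj₂ e′) =
        contradiction (∧-intro e (proj₁ (inside e′))) (euler F′ F′⊆dir F′-eulerian)

      positive : Positive F
      positive with any? (λ i → F (c i) (c (next i)) ≟ᵇ true)
      ... | no ∄ = noArcs-positive F λ e → off (F-on-cycle e) e
        where
        off : ∀ {u w} → CycleArc u w → F u w ≢ true
        off (i , refl , refl) e = ∄ (i , e)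
      -- Each cycle vertex has out-degree 1 and all others 0, so there are 4 arcs and the sign is
      -- positive.
      ... | yes (i , on) = cong sign (trans (sum-outdeg {F = F} onc outdeg-on) (count-≡ onc (tabulate c)
              (tabulate⁺ c-injective)
              (λ u e → let i , u≡ = holds (onc? u) e in subst (_∈ tabulate c) (sym u≡) (∈-tabulate⁺ {f = c} i))
              (λ u u∈ → dec-true (onc? u) (∈-tabulate⁻ u∈))))
        where
        onc? : ∀ u → Dec (∃ λ i → u ≡ c i)
        onc? u = any? λ i → u ≟ c i
        onc : Fin n → Bool
        onc u = does (onc? u)
        outdeg-on : ∀ u → outdeg F u ≡ bit (onc u)
        outdeg-on u = go (onc? u)
          where
          go : Dec (∃ λ i → u ≡ c i) → outdeg F u ≡ bit (onc u)
          go (no ∄) = trans (count-empty (F u) λ w e → let i , u≡ , _ = F-on-cycle e in ∄ (i , u≡))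
            (sym (cong bit (dec-false (onc? u) ∄)))
          go (yes (j , refl)) = trans
            (count-≡ (F (c j)) (c (next j) ∷ []) ([] ∷ []) (λ w e → here (stays e))
              λ { w (here refl) → around i on j })
            (sym (cong bit (dec-true (onc? u) (j , refl))))

  add-4-cycle : PartialOrientation G f Positive S
  add-4-cycle = record
    { dir    = arcs
    ; inside = λ {u} {w} e → inside-S (holds (arc? u w) e)
    ; edge   = λ {u} {w} e → arc-edge (holds (arc? u w) e)
    ; choice = λ {u} {w} Su Sw uw →
        map⊎ (λ (a , ¬b) → dec-true (arc? u w) a , dec-false (arc? w u) ¬b)
             (λ (¬a , b) → dec-false (arc? u w) ¬a , dec-true (arc? w u) b) (one-way Su Sw uw)
    ; bound  = arcs-bound
    ; euler  = Euler.positive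
    }

-- Nonvanishing of diff

all-true : (p : Fin n → Bool) → all p (allFin n) ≡ true → ∀ i → p i ≡ true
all-true {n} p eq i = Equivalence.to T-≡ (All.lookup (all⁺ p (allFin n) (Equivalence.from T-≡ eq)) (∈-allFin i))

true-all : (p : Fin n → Bool) → (∀ i → p i ≡ true) → all p (allFin n) ≡ true
true-all {n} p eq = Equivalence.to T-≡ (all⁻ p (All.universal (λ i → Equivalence.from T-≡ (eq i)) (allFin n)))

subRel-⊆ : {F A : BRel n} → subRel F A ≡ true → F ⊆ᵇ A
subRel-⊆ {F = F} {A} eq {u} {v} Fuv = subst (λ b → (if b then A u v else true) ≡ true) Fuv
  (all-true (λ v → if F u v then A u v else true)
    (all-true (λ u → all (λ v → if F u v then A u v else true) (allFin _)) eq u) v)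

⊆-subRel : {F A : BRel n} → (∀ u v → F u v ≡ false) → subRel F A ≡ true
⊆-subRel {F = F} {A} empty = true-all _ λ u → true-all _ λ v →
  subst (λ b → (if b then A u v else true) ≡ true) (sym (empty u v)) refl

isEulerian-sound : {F : BRel n} → isEulerian F ≡ true → Eulerian F
isEulerian-sound {F = F} eq v = ≡ᵇ⇒≡ (outdeg F v) (indeg F v)
  (Equivalence.from T-≡ (all-true (λ v → outdeg F v ≡ᵇ indeg F v) eq v))

isEulerian-complete : {F : BRel n} → Eulerian F → isEulerian F ≡ true
isEulerian-complete {F = F} eul = true-all _ λ v → Equivalence.to T-≡ (≡⇒≡ᵇ (outdeg F v) (indeg F v) (eul v))

-- This is the summand of `diff`, which is local there, in a form that agrees with it
-- definitionally.
weight : (A F : BRel n) → ℤ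
weight A F = if subRel F A ∧ isEulerian F then sign (arcCount F) else ℤ.+ 0

weight-nonNegative : {A : BRel n} → (∀ F → F ⊆ᵇ A → Eulerian F → Positive F) →
  ∀ F → ∃ λ k → weight A F ≡ ℤ.+ k
weight-nonNegative {A = A} pos F with subRel F A in sub | isEulerian F in eul
... | false | _ = 0 , refl
... | true | false = 0 , refl
... | true | true = 1 , pos F (subRel-⊆ {F = F} {A} sub) (isEulerian-sound {F = F} eul)

weight-empty : (A F : BRel n) → (∀ u v → F u v ≡ false) → weight A F ≡ ℤ.+ 1
weight-empty A F empty
  rewrite ⊆-subRel {F = F} {A} empty
        | isEulerian-complete {F = F} (λ v →
            trans (count-false (empty v)) (sym (count-false λ u → empty u v)))
  = noArcs-positive F λ {u} {v} → not-¬ (empty u v)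

no-arcs-∈ : ∀ m → replicate m false ∈ allBoolVecs m
no-arcs-∈ zero = here refl
no-arcs-∈ (suc m) = concatMap⁺ _ (Any.map (λ { refl → there (here refl) }) (no-arcs-∈ m))

-- Every summand is 0 or 1, and the all-false vector, encoding the empty sub-digraph, contributes 1;
-- nothing can cancel it.
diff-positive : {G : Graph n} (D : Orientation G) →
  (∀ F → F ⊆ᵇ arc D → Eulerian F → Positive F) → ∃ λ k → diff D ≡ ℤ.+ suc k
diff-positive {n} {G} D pos = proj₂ sums (no-arcs-∈ (n * n))
  where
  PosSum : ℤ → List (Vec Bool (n * n)) → Set
  PosSum s ws = (∃ λ k → s ≡ ℤ.+ k) × (replicate (n * n) false ∈ ws → ∃ λ k → s ≡ ℤ.+ suc k)

  add : ∀ w ws s → PosSum s ws → PosSum (weight (arc D) (toRel {n} w) ℤ.+ s) (w ∷ ws)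
  add w ws s ((k , s≡) , pos-s) with weight-nonNegative pos (toRel {n} w)
  ... | j , w≡ = (j + k , cong₂ ℤ._+_ w≡ s≡) , λ where
      (here refl) → k , cong₂ ℤ._+_ (weight-empty (arc D) (toRel {n} w) λ u v → lookup-replicate (combine u v) false) s≡
      (there ∈ws) → let l , s≡ = pos-s ∈ws in j + l , trans (cong₂ ℤ._+_ w≡ s≡) (cong ℤ.+_ (+-suc j l))

  -- The type of go mentions the local functions of diff, so it is left to unification,
  -- which finds it once the list of all sub-digraphs is abstracted.
  go : ∀ ws → _
  sums : PosSum (diff D) (allBoolVecs (n * n))
  sums with allBoolVecs (n * n)
  ... | ws = go ws
  go [] = (0 , refl) , λ ()
  go (w ∷ ws) = add w ws _ (go ws)

-- Capacities and cores

induced : Graph n → (Fin n → Bool) → DGraph n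
induced G S = record
  { Adj  = λ u v → S u ≡ true × S v ≡ true × adj G u v ≡ true
  ; adj? = λ u v → (S u ≟ᵇ true) ×-dec (S v ≟ᵇ true) ×-dec (adj G u v ≟ᵇ true)
  ; symm = λ {u} {v} (Su , Sv , uv) → Sv , Su , trans (Graph.sym G v u) uv
  ; irr  = λ {v} (_ , _ , vv) → not-¬ (irrefl G v) vv
  }

induced-free : (G : Graph n) (S : Fin n → Bool) → K4MinorFree G → ¬ K4Minor (induced G S)
induced-free G S free (b , conn , branch-edge) = free (b , nonempty , (λ i u v p q → walk (conn i u v p q)) ,
  λ i j i≢j → let u , v , p , q , _ , _ , uv = branch-edge i j i≢j in u , v , p , q , uv)
  where
  nonempty : ∀ i → ∃[ v ] b v ≡ just i
  nonempty i = let u , _ , p , _ = branch-edge i (next i) (i≢next i) in u , p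
    where
    i≢next : ∀ i → i ≢ next i
    i≢next zero ()
    i≢next (suc zero) ()
    i≢next (suc (suc zero)) ()
    i≢next (suc (suc (suc zero))) ()
  walk : ∀ {P u v} → Walk (induced G S) P u v → WalkIn G P u v
  walk (here p) = here p
  walk (step p (_ , _ , uv) w) = step p uv (walk w)

module _ {n : ℕ} (G : Graph n) (tf : TriangleFree G) (free : K4MinorFree G)
  {x y z : Fin n} (x≢y : x ≢ y) (y≢z : y ≢ z) (x≢z : x ≢ z) where

  capacity : Fin n → ℕ
  capacity v = if does (v ≟ z) then 0 else if does (v ≟ x) then 1 else if does (v ≟ y) then 1 else 2

  capacity-x : capacity x ≡ 1
  capacity-x rewrite dec-false (x ≟ z) x≢z | dec-true (x ≟ x) refl = refl

  capacity-y : capacity y ≡ 1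
  capacity-y rewrite dec-false (y ≟ z) y≢z | dec-false (y ≟ x) (≢-sym x≢y) | dec-true (y ≟ y) refl = refl

  capacity-z : capacity z ≡ 0
  capacity-z rewrite dec-true (z ≟ z) refl = refl

  capacity-other : ∀ {v} → v ≢ x → v ≢ y → v ≢ z → capacity v ≡ 2
  capacity-other {v} v≢x v≢y v≢z
    rewrite dec-false (v ≟ z) v≢z | dec-false (v ≟ x) v≢x | dec-false (v ≟ y) v≢y = refl

  triangleless : ∀ S → Triangleless (induced G S)
  triangleless S (_ , _ , ab) (_ , _ , bc) (_ , _ , ac) = tf _ _ _ ab bc ac

  module _ {S : Fin n → Bool} (core : Core G capacity S) where

    private
      R = induced G S

    -- The graph lemmas express degrees by neighbours avoiding given vertices; a core vertex can
    -- avoid as many as its capacity.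
    core-neighbour : ∀ {v} (L : List (Fin n)) → S v ≡ true → length L ≤ capacity v → ∃ λ t → Adj R v t × t ∉ L
    core-neighbour {v} L Sv ≤f = let t , e , t∉ = count-> (λ w → S w ∧ adj G v w) L (≤-<-trans ≤f (core v Sv)) in
      t , (Sv , ∧-trueˡ e , ∧-trueʳ (S t) e) , t∉

    core-edge : ∀ {v} → S v ≡ true → ∃ λ t → Adj R v t
    core-edge Sv = let t , vt , _ = core-neighbour [] Sv z≤n in t , vt

    core-notOne : ∀ {v} → capacity v ≡ 1 → NotOne R v
    core-notOne f≡1 {w} (Sv , _) =
      let t , vt , t∉ = core-neighbour (w ∷ []) Sv (≤-reflexive (sym f≡1)) in t , vt , t∉ ∘ here

    core-high : ∀ v → v ≢ x → v ≢ y → v ≢ z → Hi R v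
    core-high v v≢x v≢y v≢z (Sv , _) p q =
      let t , vt , t∉ = core-neighbour (p ∷ q ∷ []) Sv (≤-reflexive (sym (capacity-other v≢x v≢y v≢z))) in
      t , vt , t∉ ∘ here , t∉ ∘ there ∘ here

  -- Without `x` and `y`, only `z` can be exceptional, and Dirac's theorem then leaves no edge.
  no-core : ∀ {S} → Core G capacity S → S x ≢ true → S y ≢ true → ∀ v → S v ≢ true
  no-core {S} core ¬Sx ¬Sy v Sv =
    induced-free G S free (dirac₁ (induced G S) z hi (proj₂ (core-edge core Sv)))
    where
    hi : ∀ v → v ≢ z → Hi (induced G S) v
    hi v v≢z with v ≟ x | v ≟ y
    ... | yes refl | _ = λ (Sx , _) → contradiction Sx ¬Sx
    ... | no _ | yes refl = λ (Sy , _) → contradiction Sy ¬Sy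
    ... | no v≢x | no v≢y = core-high core v v≢x v≢y v≢z

  -- With two further neighbours, a would still have degree 3 after the deletion of y,
  -- making x, b and z the only exceptional vertices; but then x and b, being adjacent, would have equal neighbourhoods.
  one-more : ∀ {S a b} → Core G capacity S → Two (induced G S) x a b → Two (induced G S) y a b →
    z ≢ a → z ≢ b → ∀ {s t} → Adj (induced G S) a s → Adj (induced G S) a t →
    s ≢ x → s ≢ y → t ≢ x → t ≢ y → s ≡ t
  one-more {S} {a} {b} core Nx Ny z≢a z≢b {s} {t} as at s≢x s≢y t≢x t≢y with s ≟ t
  ... | yes s≡t = s≡t
  ... | no s≢t = contradiction
    (three-exceptional R₁ tf₁ free₁ x≢b (≢-sym x≢z) z≢b notOne-x notOne-b hi xb) impossible
    where
    R = induced G S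
    R₁ = without R y
    tf₁ : Triangleless R₁
    tf₁ = restrict-triangleless R (_≢? y) (triangleless S)
    free₁ : ¬ K4Minor R₁
    free₁ m = induced-free G S free (K4Minor-mono proj₁ m)
    a≢y : a ≢ y
    a≢y = ≢-sym (adj⇒≢ R (adj-a Ny))
    b≢y : b ≢ y
    b≢y = ≢-sym (adj⇒≢ R (adj-b Ny))
    x≢b : x ≢ b
    x≢b = adj⇒≢ R (adj-b Nx)
    xa : Adj R₁ x a
    xa = adj-a Nx , x≢y , a≢y
    xb : Adj R₁ x b
    xb = adj-b Nx , x≢y , b≢y
    notOne-x : NotOne R₁ x
    notOne-x {w} _ with a ≟ w
    ... | no a≢w = a , xa , a≢w
    ... | yes refl = b , xb , ≢-sym (a≢b Nx)
    notOne-b : NotOne R₁ b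
    notOne-b {w} (bw , _) = let t , bt , t≢w , t≢y = core-high core b (≢-sym x≢b) b≢y (≢-sym z≢b) bw w y in
      t , (bt , b≢y , t≢y) , t≢w
    hi : ∀ v → v ≢ x → v ≢ b → v ≢ z → Hi R₁ v
    hi v v≢x v≢b v≢z with v ≟ y | v ≟ a
    ... | yes refl | _ = Hi-excluded R (_≢? y) λ y≢y → y≢y refl
    ... | no v≢y | yes refl = λ _ → avoid₂ (≢-sym s≢x) (≢-sym t≢x) s≢t
      (symm R₁ xa) (as , a≢y , s≢y) (at , a≢y , t≢y)
    ... | no v≢y | no v≢a = Hi-restrict R (_≢? y)
      (λ { _ vt refl → [ v≢a , v≢b ]′ (only Ny v (symm R vt)) }) (core-high core v v≢x v≢y v≢z)
    impossible : ¬ (∃[ a ] ∃[ b′ ] (Two R₁ x a b′ × Two R₁ b a b′ × z ≢ a × z ≢ b′))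
    impossible (_ , _ , Nx₁ , Nb₁ , _) with only Nx₁ b xb
    ... | inj₁ refl = irr R₁ (adj-a Nb₁)
    ... | inj₂ refl = irr R₁ (adj-b Nb₁)

  orient-core : ∀ S → Core G capacity S → PartialOrientation G capacity Positive S
  orient-core S core with any? (λ v → S v ≟ᵇ true)
  ... | no ∄ = add-nothing (λ v Sv → ∄ (v , Sv)) noArcs-positive
  ... | yes (v , Sv) with three-exceptional (induced G S) (triangleless S) (induced-free G S free)
                           x≢y (≢-sym x≢z) (≢-sym y≢z) (core-notOne core capacity-x) (core-notOne core capacity-y)
                           (core-high core) (proj₂ (core-edge core Sv))
  ...   | a , b , Nx , Ny , z≢a , z≢b = add-4-cycle c c-injective c-adjacent c-chordless c∈S
      ∧-trueˡ outside split few
      -- A core inside `S′` contains neither `x` nor `y`, so it is empty, and the orientation of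
      -- `S′` has no nonempty Eulerian sub-digraph.
      (peel _ S′ ≤-refl λ S″ S″⊆ core″ →
        add-nothing (no-core core″ (outside (suc zero) ∘ S″⊆ x) (outside (suc (suc (suc zero))) ∘ S″⊆ y)) λ F e → e)
    where
    R = induced G S
    c : Fin 4 → Fin n
    c = lookup (a ∷ x ∷ b ∷ y ∷ [])
    onc? : ∀ v → Dec (∃ λ i → v ≡ c i)
    onc? v = any? λ i → v ≟ c i
    S′ : Fin n → Bool
    S′ v = S v ∧ not (does (onc? v))
    outside : ∀ i → S′ (c i) ≢ true
    outside i e = not-¬ (cong not (dec-true (onc? (c i)) (i , refl))) (∧-trueʳ (S (c i)) e)
    c-injective : ∀ {i j} → c i ≡ c j → i ≡ j
    c-injective = lookup-injective
      (((≢-sym (adj⇒≢ R (adj-a Nx))) ∷ a≢b Nx ∷ ≢-sym (adj⇒≢ R (adj-a Ny)) ∷ []) ∷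
       (adj⇒≢ R (adj-b Nx) ∷ x≢y ∷ []) ∷ (≢-sym (adj⇒≢ R (adj-b Ny)) ∷ []) ∷ [] ∷ []) _ _
    c-adj : ∀ i → Adj R (c i) (c (next i))
    c-adj zero = symm R (adj-a Nx)
    c-adj (suc zero) = adj-b Nx
    c-adj (suc (suc zero)) = symm R (adj-b Ny)
    c-adj (suc (suc (suc zero))) = adj-a Ny
    c-adjacent : ∀ i → adj G (c i) (c (next i)) ≡ true
    c-adjacent i = proj₂ (proj₂ (c-adj i))
    c∈S : ∀ i → S (c i) ≡ true
    c∈S i = proj₁ (c-adj i)
    ¬ab : ¬ Adj R a b
    ¬ab = two-nonadjacent (triangleless S) Nx
    ¬xy : ¬ Adj R x y
    ¬xy xy = [ (λ { refl → irr R (adj-a Ny) }) , (λ { refl → irr R (adj-b Ny) }) ]′ (only Nx y xy)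
    chordless : ∀ i j → Adj R (c i) (c j) → j ≡ next i ⊎ i ≡ next j
    chordless zero zero e = contradiction e (irr R)
    chordless zero (suc zero) _ = inj₁ refl
    chordless zero (suc (suc zero)) e = contradiction e ¬ab
    chordless zero (suc (suc (suc zero))) _ = inj₂ refl
    chordless (suc zero) zero _ = inj₂ refl
    chordless (suc zero) (suc zero) e = contradiction e (irr R)
    chordless (suc zero) (suc (suc zero)) _ = inj₁ refl
    chordless (suc zero) (suc (suc (suc zero))) e = contradiction e ¬xy
    chordless (suc (suc zero)) zero e = contradiction (symm R e) ¬ab
    chordless (suc (suc zero)) (suc zero) _ = inj₂ refl
    chordless (suc (suc zero)) (suc (suc zero)) e = contradiction e (irr R)
    chordless (suc (suc zero)) (suc (suc (suc zero))) _ = inj₁ refl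
    chordless (suc (suc (suc zero))) zero _ = inj₁ refl
    chordless (suc (suc (suc zero))) (suc zero) e = contradiction (symm R e) ¬xy
    chordless (suc (suc (suc zero))) (suc (suc zero)) _ = inj₂ refl
    chordless (suc (suc (suc zero))) (suc (suc (suc zero))) e = contradiction e (irr R)
    c-chordless : ∀ i j → adj G (c i) (c j) ≡ true → j ≡ next i ⊎ i ≡ next j
    c-chordless i j e = chordless i j (c∈S i , c∈S j , e)
    off : ∀ {v} → S′ v ≡ true → ∀ i → v ≢ c i
    off e i refl = outside i e
    split : ∀ {v} → S v ≡ true → (∃ λ i → v ≡ c i) ⊎ S′ v ≡ true
    split {v} Sv = go (onc? v)
      where
      go : Dec (∃ λ i → v ≡ c i) → (∃ λ i → v ≡ c i) ⊎ S′ v ≡ true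
      go (yes v∈c) = inj₁ v∈c
      go (no v∉c) = inj₂ (∧-intro Sv (cong not (dec-false (onc? v) v∉c)))
    Few : Fin 4 → Set
    Few i = ∃ λ (L : List (Fin n)) →
      (∀ w → S′ w ≡ true → adj G (c i) w ≡ true → w ∈ L) × suc (length L) ≤ capacity (c i)
    -- One unit of the capacity 2 of `a` or `b` pays for the cycle arc, the other for the single
    -- further neighbour.
    few-≤1 : ∀ i → capacity (c i) ≡ 2 → (∀ {s t} → Adj R (c i) s → Adj R (c i) t →
      s ≢ x → s ≢ y → t ≢ x → t ≢ y → s ≡ t) → Few i
    few-≤1 i f≡2 unique with any? (λ w → (S′ w ≟ᵇ true) ×-dec (adj G (c i) w ≟ᵇ true))
    ... | no ∄ = [] , (λ w S′w e → contradiction (w , S′w , e) ∄) , ≤-trans (s≤s z≤n) (≤-reflexive (sym f≡2))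
    ... | yes (t , S′t , it) = (t ∷ []) , (λ w S′w iw → here (unique (c∈S i , ∧-trueˡ S′w , iw) (c∈S i , ∧-trueˡ S′t , it)
        (off S′w (suc zero)) (off S′w (suc (suc (suc zero)))) (off S′t (suc zero)) (off S′t (suc (suc (suc zero)))))) ,
        ≤-reflexive (sym f≡2)
    few-none : ∀ i → capacity (c i) ≡ 1 → Two R (c i) a b → Few i
    few-none i f≡1 N = [] , (λ w S′w iw → contradiction (only N w (c∈S i , ∧-trueˡ S′w , iw))
      [ off S′w zero , off S′w (suc (suc zero)) ]′) , ≤-reflexive (sym f≡1)
    few : ∀ i → Few i
    few zero = few-≤1 zero (capacity-other (≢-sym (adj⇒≢ R (adj-a Nx))) (≢-sym (adj⇒≢ R (adj-a Ny))) (≢-sym z≢a))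
      (one-more core Nx Ny z≢a z≢b)
    few (suc zero) = few-none (suc zero) capacity-x Nx
    few (suc (suc zero)) = few-≤1 (suc (suc zero))
      (capacity-other (≢-sym (adj⇒≢ R (adj-b Nx))) (≢-sym (adj⇒≢ R (adj-b Ny))) (≢-sym z≢b))
      (one-more core (two-swap Nx) (two-swap Ny) z≢b z≢a)
    few (suc (suc (suc zero))) = few-none (suc (suc (suc zero))) capacity-y Ny

theorem3 : ∀ (n : ℕ) (G : Graph n) → TriangleFree G → K4MinorFree G →
    ∀ (x y z : Fin n) → x ≢ y → y ≢ z → x ≢ z → Extendable221 G x y z
theorem3 n G tf free x y z x≢y y≢z x≢z =
    D
  , (λ diff≡0 → let k , diff≡ = diff-positive D euler in case trans (sym diff≡) diff≡0 of λ ())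
  , subst (outdeg dir x ≤_) (capacity-x G tf free x≢y y≢z x≢z) (bound x)
  , subst (outdeg dir y ≤_) (capacity-y G tf free x≢y y≢z x≢z) (bound y)
  , n≤0⇒n≡0 (subst (outdeg dir z ≤_) (capacity-z G tf free x≢y y≢z x≢z) (bound z))
  , (λ v v≢x v≢y v≢z → subst (outdeg dir v ≤_) (capacity-other G tf free x≢y y≢z x≢z v≢x v≢y v≢z) (bound v))
  where
  open PartialOrientation (peel {G = G} _ (λ _ → true) ≤-refl λ S _ → orient-core G tf free x≢y y≢z x≢z S)
  D : Orientation G
  D = record { arc = dir ; arc⊆edge = λ _ _ → edge ; oriented = λ _ _ → choice refl refl }
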